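{- Let $G$ be a cycle with $n$ vertices. There is a constant $c>0$ such that for every $N\ge1$, if $R$ and $S$ are independent random walks on $G$, then the probability that the tokens can be scheduled so that each is advanced $N$ steps along its walk without a collision is less than $e^{ -cN^{1/3}}$.
   Context: A walk on $G$ is an infinite sequence $R(1),R(2),\ldots$ of vertices with consecutive vertices adjacent. A random walk on $G$: $R(1)$ uniform among vertices, each $R(i+1)$ uniform among neighbours of $R(i)$. Tokens $T_R,T_S$ start at $R(1),S(1)$; a move advances exactly one token one step along its own walk; a collision occurs if the two tokens ever occupy the same vertex at the same time (including initially). -}

module Defs where

open import Data.Bool using (Bool; true; false; _∧_; _∨_; not; T?)
open import Data.Nat using (ℕ; zero; suc; _+_; _*_; _^_; _∸_; NonZero)
open import Data.Nat.DivMod using (_mod_)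
open import Data.Fin using (Fin; toℕ)
open import Data.Fin.Properties using (_≟_)
open import Data.List using (List; []; _∷_; concatMap; map; length; filter; allFin)
open import Data.Product using (Σ; _×_; _,_; proj₁; proj₂)
open import Relation.Nullary.Decidable using (⌊_⌋)
open import Data.Integer using (+_)
open import Data.Rational as ℚ using (ℚ)

-- The cycle C_n on vertex set Fin n: vertex v is adjacent to v+1 and v-1 (mod n).
-- For n ≥ 3 these two neighbours are distinct, so a uniformly random neighbour
-- is the same as a uniformly random direction (true = +1, false = -1).
stepC : (n : ℕ) → .{{_ : NonZero n}} → Fin n → Bool → Fin n
stepC n v true  = (suc (toℕ v)) mod n
stepC n v false = (toℕ v + (n ∸ 1)) mod n

walk : (n : ℕ) → .{{_ : NonZero n}} → Fin n → List Bool → List (Fin n)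
walk n v []       = v ∷ []
walk n v (d ∷ ds) = v ∷ walk n (stepC n v d) ds

noColl : {n : ℕ} → Fin n → Fin n → Bool
noColl r s = not ⌊ r ≟ s ⌋

-- can rs ss = true iff the tokens, currently at the heads of rs and ss, can be
-- moved (one token one step along its own walk per move) until both reach the
-- last vertex of their lists, without ever occupying the same vertex
-- simultaneously (including the current configuration).
can : {n : ℕ} → List (Fin n) → List (Fin n) → Bool
can [] _ = false
can (_ ∷ _) [] = false
can (r ∷ []) (s ∷ []) = noColl r s
can (r ∷ r′ ∷ rs) (s ∷ []) = noColl r s ∧ can (r′ ∷ rs) (s ∷ [])
can (r ∷ []) (s ∷ s′ ∷ ss) = noColl r s ∧ can (r ∷ []) (s′ ∷ ss)
can (r ∷ r′ ∷ rs) (s ∷ s′ ∷ ss) =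
  noColl r s ∧ (can (r′ ∷ rs) (s ∷ s′ ∷ ss) ∨ can (r ∷ r′ ∷ rs) (s′ ∷ ss))

dirs : ℕ → List (List Bool)
dirs zero = [] ∷ []
dirs (suc N) = concatMap (λ ds → (true ∷ ds) ∷ (false ∷ ds) ∷ []) (dirs N)

outcomes : (n : ℕ) → ℕ → List (Fin n × List Bool)
outcomes n N = concatMap (λ v → map (λ ds → (v , ds)) (dirs N)) (allFin n)

goodCount : (n : ℕ) → .{{_ : NonZero n}} → ℕ → ℕ
goodCount n N =
  length (filter (λ p → T? (can (walk n (proj₁ (proj₁ p)) (proj₂ (proj₁ p)))
                               (walk n (proj₁ (proj₂ p)) (proj₂ (proj₂ p)))))
          (concatMap (λ x → map (λ y → (x , y)) (outcomes n N)) (outcomes n N)))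

-- total number of equally likely pairs of outcomes: (n·2^N)^2.
-- The probability in the theorem is  goodCount n N / totalCount n N.
totalCount : ℕ → ℕ → ℕ
totalCount n N = (n * 2 ^ N) * (n * 2 ^ N)

expTerm : ℚ → ℕ → ℚ
expTerm s zero    = ℚ.1ℚ
expTerm s (suc k) = expTerm s k ℚ.* (s ℚ.* (+ 1 ℚ./ suc k))

expPartial : ℚ → ℕ → ℚ
expPartial s zero    = ℚ.0ℚ
expPartial s (suc k) = expPartial s k ℚ.+ expTerm s k

-- For s ≥ 0 and D > 0:  ProbBelowExpNeg s C D  ⟺  C / D < e^{-s}.
-- (e^s is the supremum of the partial sums, so C/D · e^s < 1 iff there is a
-- rational upper bound u of all partial sums with u · C < D.)
ProbBelowExpNeg : ℚ → ℕ → ℕ → Set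
ProbBelowExpNeg s C D =
  Σ ℚ (λ u → ((k : ℕ) → expPartial s k ℚ.≤ u) × (u ℚ.* (+ C ℚ./ 1) ℚ.< (+ D ℚ./ 1)))

{-# OPTIONS --safe #-}

-- Lift both walks to ℤ so that a collision-free schedule keeps the tokens at
-- distance less than n. With probability exponentially close to 1 in N / L² the
-- first walk leaves an interval of radius L, say upwards; the other case is its
-- mirror image. Cut its way up into stages of height 6n and record one bit per
-- stage: does the walk, after its maximum has entered the stage and before it has
-- left it, fall back by 4n? Since the second token stays within distance n, a 1 makes
-- the second walk fall back by a slightly smaller amount during a slightly longer
-- stage, and a 0 forbids it to fall back by a slightly larger amount during a
-- slightly shorter stage. By the gambler's ruin either demand is met with probability 3/4,
-- whatever the bits are, so L / 6n stages are all survived with probability (3/4)^(L / 6n).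
-- Taking L proportional to N^(1/3) balances the two estimates.
module Submission where

open import Defs
open import Data.Bool using (Bool; true; false; T; T?; _∧_)
open import Data.Bool.Properties using (T-∧; T-∨)
open import Data.Empty using (⊥; ⊥-elim)
open import Data.Fin using (Fin; toℕ)
open import Data.Fin.Properties using (toℕ-injective; toℕ-fromℕ<; toℕ<n; _≟_)
open import Data.Integer as ℤ using (ℤ)
import Data.Integer.Properties as ℤₚ
import Data.Integer.Tactic.RingSolver as ℤ-Solver
open import Data.List using (List; []; _∷_; map; concatMap; length; filter; allFin; _++_)
open import Data.List.Membership.Propositional using (_∈_)
open import Data.List.Membership.Propositional.Properties using (∈-allFin)
open import Data.List.Properties using (length-tabulate; map-++; map-∘)
open import Data.List.Relation.Unary.Any using (here; there)
open import Data.Nat using (ℕ; zero; suc; _+_; _*_; _^_; _∸_; _!; _≤_; _<_; z≤n; s≤s;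
  NonZero; >-nonZero; >-nonZero⁻¹)
open import Data.Nat.DivMod
open import Data.Nat.ListAction using (sum)
open import Data.Nat.ListAction.Properties using (sum-++)
open import Data.Nat.Properties hiding (_≟_)
open import Data.Nat.Tactic.RingSolver using (solve-∀)
open import Data.Product using (Σ; _×_; _,_; proj₁; proj₂; ∃)
open import Data.Rational as ℚ using (ℚ; 0ℚ; 1ℚ; ½)
import Data.Rational.Properties as ℚₚ
open import Data.Rational.Solver using (module +-*-Solver)
import Data.Rational.Unnormalised as ℚᵘ
import Data.Rational.Unnormalised.Properties as ℚᵘₚ
open import Data.Sum using (_⊎_; inj₁; inj₂)
open import Data.Unit using (⊤; tt)
open import Function using (_∘_; id; Equivalence)
open import Relation.Binary.PropositionalEquality
open import Relation.Nullary using (¬_; Dec; yes; no; contradiction)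
open import Relation.Nullary.Decidable using (⌊_⌋; _×-dec_)

open Equivalence using (to)

-- Counting words and schedulable pairs

-- Fixing the first walk fixes the bits, so only the second walk has to be counted, and a bound
-- uniform in the bits can then be summed over all first walks. Thresholds are multiples of `n`:
-- tokens less than `n` apart see each other's thresholds with an error below one level, and the
-- constants of a stage are what this margin dictates. Relative to the stage, the first token uses
-- levels 1, 5, 9. The second must fall from 4 to 2 before it sees 10, or must rise from 6 to 8
-- before it sees 0. Both are games of width 8 with favourable share 6, namely (10 - 4) / (10 - 2)
-- and (6 - 0) / (8 - 0), hence the common factor 3/4. Stages are 6 levels apart so that the windows
-- 4 to 10 of the second token abut and its demands come one after the other. For small `N` the
-- asymptotic estimate is void, although the bound must be below 1 there too; in that range the loss
-- of the fraction 1/n of pairs that start on a common vertex is enough.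

private
  variable
    A B : Set

indicator : Bool → ℕ
indicator true  = 1
indicator false = 0

indicator≤1 : ∀ b → indicator b ≤ 1
indicator≤1 true  = ≤-refl
indicator≤1 false = z≤n

sumOver : (A → ℕ) → List A → ℕ
sumOver g xs = sum (map g xs)

-- Branching on the first letter makes the first-step analysis of a walk hold by computation; `dirs`
-- lists the same words with the two first letters interleaved.
wordSum : (List Bool → ℕ) → ℕ → ℕ
wordSum g zero    = g []
wordSum g (suc N) = wordSum (g ∘ (true ∷_)) N + wordSum (g ∘ (false ∷_)) N

length-filter-T : ∀ (f : A → Bool) xs →
  length (filter (λ x → T? (f x)) xs) ≡ sumOver (indicator ∘ f) xs
length-filter-T f []       = refl
length-filter-T f (x ∷ xs) with f x
... | true  = cong suc (length-filter-T f xs)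
... | false = length-filter-T f xs

sumOver-++ : ∀ (g : A → ℕ) xs ys → sumOver g (xs ++ ys) ≡ sumOver g xs + sumOver g ys
sumOver-++ g xs ys = trans (cong sum (map-++ g xs ys)) (sum-++ (map g xs) (map g ys))

sumOver-pairs : ∀ (g : A × B → ℕ) xs ys →
  sumOver g (concatMap (λ x → map (x ,_) ys) xs) ≡
  sumOver (λ x → sumOver (λ y → g (x , y)) ys) xs
sumOver-pairs g []       ys = refl
sumOver-pairs g (x ∷ xs) ys = trans
  (sumOver-++ g (map (x ,_) ys) (concatMap (λ x → map (x ,_) ys) xs))
  (cong₂ _+_ (cong sum (sym (map-∘ ys))) (sumOver-pairs g xs ys))

sumOver-dirs : ∀ g N → sumOver g (dirs N) ≡ wordSum g N
sumOver-dirs g zero    = +-identityʳ (g [])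
sumOver-dirs g (suc N) = trans (split (dirs N))
  (cong₂ _+_ (sumOver-dirs (g ∘ (true ∷_)) N) (sumOver-dirs (g ∘ (false ∷_)) N))
  where
  interchange : ∀ a b c d → a + (b + (c + d)) ≡ (a + c) + (b + d)
  interchange = solve-∀
  split : ∀ ws → sumOver g (concatMap (λ ds → (true ∷ ds) ∷ (false ∷ ds) ∷ []) ws) ≡
                 sumOver (g ∘ (true ∷_)) ws + sumOver (g ∘ (false ∷_)) ws
  split []       = refl
  split (w ∷ ws) = trans (cong (λ s → g (true ∷ w) + (g (false ∷ w) + s)) (split ws))
                         (interchange (g (true ∷ w)) (g (false ∷ w)) _ _)

sumOver-mono : ∀ {g h : A → ℕ} → (∀ x → g x ≤ h x) → ∀ xs → sumOver g xs ≤ sumOver h xs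
sumOver-mono g≤h []       = z≤n
sumOver-mono g≤h (x ∷ xs) = +-mono-≤ (g≤h x) (sumOver-mono g≤h xs)

sumOver-cong : ∀ {g h : A → ℕ} → (∀ x → g x ≡ h x) → ∀ xs → sumOver g xs ≡ sumOver h xs
sumOver-cong g≡h []       = refl
sumOver-cong g≡h (x ∷ xs) = cong₂ _+_ (g≡h x) (sumOver-cong g≡h xs)

sumOver-const : ∀ c (xs : List A) → sumOver (λ _ → c) xs ≡ length xs * c
sumOver-const c []       = refl
sumOver-const c (x ∷ xs) = cong (c +_) (sumOver-const c xs)

sumOver-scale : ∀ c (g : A → ℕ) xs → sumOver (λ x → c * g x) xs ≡ c * sumOver g xs
sumOver-scale c g []       = sym (*-zeroʳ c)
sumOver-scale c g (x ∷ xs) = trans (cong (c * g x +_) (sumOver-scale c g xs))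
                                   (sym (*-distribˡ-+ c (g x) (sumOver g xs)))

-- Meant for the partners that start on the vertex of the first token: one vanishing term costs a
-- full `B`.
sumOver-missing : ∀ {g : A → ℕ} {B x xs} → (∀ y → g y ≤ B) → g x ≡ 0 → x ∈ xs →
  sumOver g xs + B ≤ length xs * B
sumOver-missing {g = g} {B} {xs = y ∷ xs} g≤B gx≡0 (here refl) rewrite gx≡0 =
  subst (_≤ B + length xs * B) (+-comm B _)
    (+-monoʳ-≤ B (≤-trans (sumOver-mono g≤B xs) (≤-reflexive (sumOver-const B xs))))
sumOver-missing {g = g} {B} {xs = y ∷ xs} g≤B gx≡0 (there x∈xs) =
  subst (_≤ B + length xs * B) (sym (+-assoc (g y) (sumOver g xs) B))
    (+-mono-≤ (g≤B y) (sumOver-missing g≤B gx≡0 x∈xs))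

wordSum-mono : ∀ {g h} → (∀ w → g w ≤ h w) → ∀ N → wordSum g N ≤ wordSum h N
wordSum-mono g≤h zero    = g≤h []
wordSum-mono g≤h (suc N) =
  +-mono-≤ (wordSum-mono (g≤h ∘ (true ∷_)) N) (wordSum-mono (g≤h ∘ (false ∷_)) N)

wordSum-const : ∀ c N → wordSum (λ _ → c) N ≡ 2 ^ N * c
wordSum-const c zero    = sym (+-identityʳ c)
wordSum-const c (suc N) = trans (cong₂ _+_ (wordSum-const c N) (wordSum-const c N))
                                (double (2 ^ N) c)
  where
  double : ∀ a c → a * c + a * c ≡ (2 * a) * c
  double = solve-∀

wordSum-affine : ∀ a b g N → wordSum (λ w → a * g w + b) N ≡ a * wordSum g N + 2 ^ N * b
wordSum-affine a b g zero    = cong (a * g [] +_) (sym (+-identityʳ b))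
wordSum-affine a b g (suc N) =
  trans (cong₂ _+_ (wordSum-affine a b (g ∘ (true ∷_)) N) (wordSum-affine a b (g ∘ (false ∷_)) N))
        (collect a b (2 ^ N) (wordSum (g ∘ (true ∷_)) N) (wordSum (g ∘ (false ∷_)) N))
  where
  collect : ∀ a b p s t → (a * s + p * b) + (a * t + p * b) ≡ a * (s + t) + (2 * p) * b
  collect = solve-∀

wordSum-indicator≤ : ∀ (f : List Bool → Bool) N → wordSum (indicator ∘ f) N ≤ 2 ^ N
wordSum-indicator≤ f N = ≤-trans (wordSum-mono (indicator≤1 ∘ f) N)
  (≤-reflexive (trans (wordSum-const 1 N) (*-identityʳ _)))

module _ (n : ℕ) .{{_ : NonZero n}} where

  schedulable : Fin n → List Bool → Fin n → List Bool → Bool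
  schedulable v ds w es = can (walk n v ds) (walk n w es)

  goodPartners : ℕ → Fin n → List Bool → ℕ
  goodPartners N v ds =
    sumOver (λ w → wordSum (indicator ∘ schedulable v ds w) N) (allFin n)

  sumOver-outcomes : ∀ (g : Fin n × List Bool → ℕ) N →
    sumOver g (outcomes n N) ≡ sumOver (λ v → wordSum (λ ds → g (v , ds)) N) (allFin n)
  sumOver-outcomes g N = trans (sumOver-pairs g (allFin n) (dirs N))
    (sumOver-cong (λ v → sumOver-dirs (λ ds → g (v , ds)) N) (allFin n))

  goodCount-sum : ∀ N →
    goodCount n N ≡ sumOver (λ v → wordSum (goodPartners N v) N) (allFin n)
  goodCount-sum N = begin
    goodCount n N
      ≡⟨ length-filter-T good (concatMap (λ x → map (x ,_) (outcomes n N)) (outcomes n N)) ⟩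
    sumOver (indicator ∘ good) (concatMap (λ x → map (x ,_) (outcomes n N)) (outcomes n N))
      ≡⟨ sumOver-pairs (indicator ∘ good) (outcomes n N) (outcomes n N) ⟩
    sumOver (λ x → sumOver (λ y → indicator (good (x , y))) (outcomes n N)) (outcomes n N)
      ≡⟨ sumOver-cong (λ x → sumOver-outcomes (λ y → indicator (good (x , y))) N) (outcomes n N) ⟩
    sumOver (λ x → goodPartners N (proj₁ x) (proj₂ x)) (outcomes n N)
      ≡⟨ sumOver-outcomes (λ x → goodPartners N (proj₁ x) (proj₂ x)) N ⟩
    sumOver (λ v → wordSum (goodPartners N v) N) (allFin n) ∎
    where
    open ≡-Reasoning
    good : (Fin n × List Bool) × (Fin n × List Bool) → Bool
    good p = schedulable (proj₁ (proj₁ p)) (proj₂ (proj₁ p)) (proj₁ (proj₂ p)) (proj₂ (proj₂ p))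

-- Lifting the cycle to the integers

-- σ = true reads the direction true as +1, σ = false reads it as −1.
move : Bool → Bool → ℤ → ℤ
move true  true  u = ℤ.suc u
move true  false u = ℤ.pred u
move false true  u = ℤ.pred u
move false false u = ℤ.suc u

module _ (n : ℕ) .{{_ : NonZero n}} where

  -- The index is the lifted offset of the first token ahead of the second. It has
  -- no lower bound besides being a natural number, which is all the lift needs.
  data Schedule : ℕ → List Bool → List Bool → Set where
    stop     : ∀ {d} → Schedule d [] []
    forth₁   : ∀ {d ds es} → suc d < n → Schedule (suc d) ds es → Schedule d (true ∷ ds) es
    back₁    : ∀ {d ds es} → Schedule d ds es → Schedule (suc d) (false ∷ ds) es
    forth₂   : ∀ {d ds es} → Schedule d ds es → Schedule (suc d) ds (true ∷ es)
    back₂    : ∀ {d ds es} → suc d < n → Schedule (suc d) ds es → Schedule d ds (false ∷ es)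

  _leads_by_ : Fin n → Fin n → ℕ → Set
  r leads s by d = toℕ r ≡ (toℕ s + d) % n

  leads⇒≢0 : ∀ {r s d} → r leads s by d → r ≢ s → d ≢ 0
  leads⇒≢0 {r} {s} eq r≢s refl = r≢s (toℕ-injective
    (trans eq (trans (cong (_% n) (+-identityʳ (toℕ s))) (m<n⇒m%n≡m (toℕ<n s)))))

  leads⇒≢n : ∀ {r s d} → r leads s by d → r ≢ s → d ≢ n
  leads⇒≢n {r} {s} eq r≢s refl = r≢s (toℕ-injective
    (trans eq (trans ([m+n]%n≡m%n (toℕ s) n) (m<n⇒m%n≡m (toℕ<n s)))))

  %-absorbˡ : ∀ a b → (a % n + b) % n ≡ (a + b) % n
  %-absorbˡ a b = trans (%-distribˡ-+ (a % n) b n)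
    (trans (cong (λ x → (x + b % n) % n) (m%n%n≡m%n a n)) (sym (%-distribˡ-+ a b n)))

  toℕ-mod : ∀ a → toℕ (a mod n) ≡ a % n
  toℕ-mod a = toℕ-fromℕ< (m%n<n a n)

  n≡1+pred : n ≡ suc (n ∸ 1)
  n≡1+pred = sym (suc-pred n)

  leads-forth₁ : ∀ {r s d} → r leads s by d → stepC n r true leads s by suc d
  leads-forth₁ {r} {s} {d} eq = begin
    toℕ (stepC n r true)     ≡⟨ toℕ-mod (suc (toℕ r)) ⟩
    suc (toℕ r) % n          ≡⟨ cong (_% n) (trans (cong suc eq) (+-comm 1 _)) ⟩
    ((toℕ s + d) % n + 1) % n ≡⟨ %-absorbˡ (toℕ s + d) 1 ⟩
    (toℕ s + d + 1) % n      ≡⟨ cong (_% n) (trans (+-assoc (toℕ s) d 1) (cong (toℕ s +_) (+-comm d 1))) ⟩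
    (toℕ s + suc d) % n      ∎
    where open ≡-Reasoning

  leads-back₁ : ∀ {r s d} → r leads s by suc d → stepC n r false leads s by d
  leads-back₁ {r} {s} {d} eq = begin
    toℕ (stepC n r false)                ≡⟨ toℕ-mod (toℕ r + (n ∸ 1)) ⟩
    (toℕ r + (n ∸ 1)) % n                ≡⟨ cong (λ x → (x + (n ∸ 1)) % n) eq ⟩
    ((toℕ s + suc d) % n + (n ∸ 1)) % n  ≡⟨ %-absorbˡ (toℕ s + suc d) (n ∸ 1) ⟩
    (toℕ s + suc d + (n ∸ 1)) % n        ≡⟨ cong (_% n) (shift (toℕ s) d (n ∸ 1)) ⟩
    (toℕ s + d + suc (n ∸ 1)) % n        ≡⟨ cong (λ x → (toℕ s + d + x) % n) (sym n≡1+pred) ⟩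
    (toℕ s + d + n) % n                  ≡⟨ [m+n]%n≡m%n (toℕ s + d) n ⟩
    (toℕ s + d) % n                      ∎
    where
    open ≡-Reasoning
    shift : ∀ a b c → a + suc b + c ≡ a + b + suc c
    shift = solve-∀

  leads-forth₂ : ∀ {r s d} → r leads s by suc d → r leads stepC n s true by d
  leads-forth₂ {r} {s} {d} eq = sym (begin
    (toℕ (stepC n s true) + d) % n   ≡⟨ cong (λ x → (x + d) % n) (toℕ-mod (suc (toℕ s))) ⟩
    (suc (toℕ s) % n + d) % n        ≡⟨ %-absorbˡ (suc (toℕ s)) d ⟩
    (suc (toℕ s) + d) % n            ≡⟨ cong (_% n) (sym (+-suc (toℕ s) d)) ⟩
    (toℕ s + suc d) % n              ≡⟨ sym eq ⟩
    toℕ r                            ∎)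
    where open ≡-Reasoning

  leads-back₂ : ∀ {r s d} → r leads s by d → r leads stepC n s false by suc d
  leads-back₂ {r} {s} {d} eq = sym (begin
    (toℕ (stepC n s false) + suc d) % n    ≡⟨ cong (λ x → (x + suc d) % n) (toℕ-mod (toℕ s + (n ∸ 1))) ⟩
    ((toℕ s + (n ∸ 1)) % n + suc d) % n    ≡⟨ %-absorbˡ (toℕ s + (n ∸ 1)) (suc d) ⟩
    (toℕ s + (n ∸ 1) + suc d) % n          ≡⟨ cong (_% n) (shift (toℕ s) (n ∸ 1) d) ⟩
    (toℕ s + d + suc (n ∸ 1)) % n          ≡⟨ cong (λ x → (toℕ s + d + x) % n) (sym n≡1+pred) ⟩
    (toℕ s + d + n) % n                    ≡⟨ [m+n]%n≡m%n (toℕ s + d) n ⟩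
    (toℕ s + d) % n                        ≡⟨ sym eq ⟩
    toℕ r                                  ∎)
    where
    open ≡-Reasoning
    shift : ∀ a b c → a + b + suc c ≡ a + c + suc b
    shift = solve-∀

  noColl⇒≢ : ∀ {r s : Fin n} → T (noColl r s) → r ≢ s
  noColl⇒≢ {r} {s} t r≡s with r ≟ s
  ... | no r≢s = r≢s r≡s

  -- The nine cases are forced by `can`, which reduces only once each list is known to be a
  -- singleton or longer.
  schedulable⇒≢ : ∀ v ds w es → T (schedulable n v ds w es) → v ≢ w
  schedulable⇒≢ v []           w []           t = noColl⇒≢ t
  schedulable⇒≢ v (_ ∷ [])     w []           t = noColl⇒≢ (proj₁ (to T-∧ t))
  schedulable⇒≢ v (_ ∷ _ ∷ _)  w []           t = noColl⇒≢ (proj₁ (to T-∧ t))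
  schedulable⇒≢ v []           w (_ ∷ [])     t = noColl⇒≢ (proj₁ (to T-∧ t))
  schedulable⇒≢ v []           w (_ ∷ _ ∷ _)  t = noColl⇒≢ (proj₁ (to T-∧ t))
  schedulable⇒≢ v (_ ∷ [])     w (_ ∷ [])     t = noColl⇒≢ (proj₁ (to T-∧ t))
  schedulable⇒≢ v (_ ∷ [])     w (_ ∷ _ ∷ _)  t = noColl⇒≢ (proj₁ (to T-∧ t))
  schedulable⇒≢ v (_ ∷ _ ∷ _)  w (_ ∷ [])     t = noColl⇒≢ (proj₁ (to T-∧ t))
  schedulable⇒≢ v (_ ∷ _ ∷ _)  w (_ ∷ _ ∷ _)  t = noColl⇒≢ (proj₁ (to T-∧ t))

  Advance₁ Advance₂ : Fin n → List Bool → Fin n → List Bool → Set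
  Advance₁ v []       w es = ⊥
  Advance₁ v (d ∷ ds) w es = T (schedulable n (stepC n v d) ds w es)
  Advance₂ v ds w []       = ⊥
  Advance₂ v ds w (e ∷ es) = T (schedulable n v ds (stepC n w e) es)

  schedulable-first : ∀ v ds w es → T (schedulable n v ds w es) →
    (ds ≡ [] × es ≡ []) ⊎ Advance₁ v ds w es ⊎ Advance₂ v ds w es
  schedulable-first v []           w []           t = inj₁ (refl , refl)
  schedulable-first v (_ ∷ [])     w []           t = inj₂ (inj₁ (proj₂ (to T-∧ t)))
  schedulable-first v (_ ∷ _ ∷ _)  w []           t = inj₂ (inj₁ (proj₂ (to T-∧ t)))
  schedulable-first v []           w (_ ∷ [])     t = inj₂ (inj₂ (proj₂ (to T-∧ t)))
  schedulable-first v []           w (_ ∷ _ ∷ _)  t = inj₂ (inj₂ (proj₂ (to T-∧ t)))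
  schedulable-first v (_ ∷ [])     w (_ ∷ [])     t = inj₂ (to T-∨ (proj₂ (to (T-∧ {noColl v w}) t)))
  schedulable-first v (_ ∷ [])     w (_ ∷ _ ∷ _)  t = inj₂ (to T-∨ (proj₂ (to (T-∧ {noColl v w}) t)))
  schedulable-first v (_ ∷ _ ∷ _)  w (_ ∷ [])     t = inj₂ (to T-∨ (proj₂ (to (T-∧ {noColl v w}) t)))
  schedulable-first v (_ ∷ _ ∷ _)  w (_ ∷ _ ∷ _)  t = inj₂ (to T-∨ (proj₂ (to (T-∧ {noColl v w}) t)))

  -- A collision is an offset divisible by `n`, and the offset changes by one per move, so it is
  -- trapped: reaching `n` is refuted by the configuration after the move, and dropping below 0 by
  -- the configuration before it.
  schedule : ∀ v ds w es d → v leads w by d → d < n → T (schedulable n v ds w es) →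
             Schedule d ds es
  schedule v ds w es d eq d<n t with schedulable-first v ds w es t
  ... | inj₁ (refl , refl) = stop
  schedule v (true ∷ ds) w es d eq d<n t | inj₂ (inj₁ t′) =
    forth₁ d′<n (schedule _ ds w es (suc d) eq′ d′<n t′)
    where
    eq′ = leads-forth₁ {v} {w} eq
    d′<n = ≤∧≢⇒< d<n (leads⇒≢n {s = w} eq′ (schedulable⇒≢ _ ds w es t′))
  schedule v (false ∷ ds) w es zero eq d<n t | inj₂ (inj₁ t′) =
    ⊥-elim (leads⇒≢0 {s = w} eq (schedulable⇒≢ v (false ∷ ds) w es t) refl)
  schedule v (false ∷ ds) w es (suc d) eq d<n t | inj₂ (inj₁ t′) =
    back₁ (schedule _ ds w es d (leads-back₁ {v} {w} eq) (<-trans (n<1+n d) d<n) t′)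
  schedule v ds w (true ∷ es) zero eq d<n t | inj₂ (inj₂ t′) =
    ⊥-elim (leads⇒≢0 {s = w} eq (schedulable⇒≢ v ds w (true ∷ es) t) refl)
  schedule v ds w (true ∷ es) (suc d) eq d<n t | inj₂ (inj₂ t′) =
    forth₂ (schedule v ds _ es d (leads-forth₂ {v} {w} eq) (<-trans (n<1+n d) d<n) t′)
  schedule v ds w (false ∷ es) d eq d<n t | inj₂ (inj₂ t′) =
    back₂ d′<n (schedule v ds _ es (suc d) eq′ d′<n t′)
    where
    eq′ = leads-back₂ {v} {w} eq
    d′<n = ≤∧≢⇒< d<n (leads⇒≢n {s = stepC n w false} eq′ (schedulable⇒≢ v ds _ es t′))

  lead : ∀ v w → ∃ λ d → v leads w by d × d < n
  lead v w = (toℕ v + (n ∸ toℕ w)) % n , sym eq , m%n<n _ n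
    where
    open ≡-Reasoning
    rearrange : ∀ a b c → a + (b + c) ≡ b + (c + a)
    rearrange = solve-∀
    eq : (toℕ w + (toℕ v + (n ∸ toℕ w)) % n) % n ≡ toℕ v
    eq = begin
      (toℕ w + (toℕ v + (n ∸ toℕ w)) % n) % n  ≡⟨ cong (_% n) (+-comm (toℕ w) _) ⟩
      ((toℕ v + (n ∸ toℕ w)) % n + toℕ w) % n  ≡⟨ %-absorbˡ (toℕ v + (n ∸ toℕ w)) (toℕ w) ⟩
      (toℕ v + (n ∸ toℕ w) + toℕ w) % n        ≡⟨ cong (_% n) (+-assoc (toℕ v) _ _) ⟩
      (toℕ v + (n ∸ toℕ w + toℕ w)) % n        ≡⟨ cong (λ x → (toℕ v + x) % n) (m∸n+n≡m (<⇒≤ (toℕ<n w))) ⟩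
      (toℕ v + n) % n                          ≡⟨ [m+n]%n≡m%n (toℕ v) n ⟩
      toℕ v % n                                ≡⟨ m<n⇒m%n≡m (toℕ<n v) ⟩
      toℕ v                                    ∎

move-≤ : ∀ σ d {u t} → u ℤ.< t → move σ d u ℤ.≤ t
move-≤ true  true  u<t = ℤₚ.i<j⇒suc[i]≤j u<t
move-≤ true  false u<t = ℤₚ.i≤j⇒pred[i]≤j (ℤₚ.<⇒≤ u<t)
move-≤ false true  u<t = ℤₚ.i≤j⇒pred[i]≤j (ℤₚ.<⇒≤ u<t)
move-≤ false false u<t = ℤₚ.i<j⇒suc[i]≤j u<t

move-≥ : ∀ σ d {u t} → t ℤ.< u → t ℤ.≤ move σ d u
move-≥ true  true  t<u = ℤₚ.i≤j⇒i≤1+j (ℤₚ.<⇒≤ t<u)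
move-≥ true  false t<u = ℤₚ.i<j⇒i≤pred[j] t<u
move-≥ false true  t<u = ℤₚ.i<j⇒i≤pred[j] t<u
move-≥ false false t<u = ℤₚ.i≤j⇒i≤1+j (ℤₚ.<⇒≤ t<u)

-- Stages of the first walk and demands on the second

module _ (n : ℕ) .{{_ : NonZero n}} where

  level : ℕ → ℤ
  level zero    = ℤ.0ℤ
  level (suc j) = ℤ.+ n ℤ.+ level j

  private
    0<n : ℤ.0ℤ ℤ.< ℤ.+ n
    0<n = ℤ.+<+ (>-nonZero⁻¹ n)

  i<n+i : ∀ i → i ℤ.< ℤ.+ n ℤ.+ i
  i<n+i i = subst (ℤ._< ℤ.+ n ℤ.+ i) (ℤₚ.+-identityˡ i) (ℤₚ.+-monoˡ-< i 0<n)

  level-< : ∀ k j → level j ℤ.< level (suc k + j)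
  level-< zero    j = i<n+i (level j)
  level-< (suc k) j = ℤₚ.<-trans (level-< k j) (i<n+i _)

  level-mono : ∀ {j k} → j ≤ k → level j ℤ.≤ level k
  level-mono {k = k} z≤n = nonneg k
    where
    nonneg : ∀ k → ℤ.0ℤ ℤ.≤ level k
    nonneg zero    = ℤₚ.≤-refl
    nonneg (suc k) = ℤₚ.≤-trans (nonneg k) (ℤₚ.<⇒≤ (i<n+i _))
  level-mono (s≤s j≤k) = ℤₚ.+-monoʳ-≤ (ℤ.+ n) (level-mono j≤k)

  Near : ℤ → ℤ → Set
  Near u v = u ℤ.< ℤ.+ n ℤ.+ v × v ℤ.< ℤ.+ n ℤ.+ u

  Near-sym : ∀ {u v} → Near u v → Near v u
  Near-sym (p , q) = q , p

  -- Together with `near-below`, this is how closeness enters the coupling: a threshold met by one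
  -- token is passed on to the other with a shift of one level.
  near-above : ∀ {u v} j → Near u v → level (suc j) ℤ.≤ u → level j ℤ.< v
  near-above j (u<n+v , _) l≤u = ℤₚ.≰⇒> λ v≤l →
    ℤₚ.<⇒≱ (ℤₚ.≤-<-trans l≤u u<n+v) (ℤₚ.+-monoʳ-≤ (ℤ.+ n) v≤l)

  near-below : ∀ {u v} j → Near u v → u ℤ.≤ level j → v ℤ.< level (suc j)
  near-below j (_ , v<n+u) u≤l = ℤₚ.<-≤-trans v<n+u (ℤₚ.+-monoʳ-≤ (ℤ.+ n) u≤l)

  -- Stage j of the first token concerns its maximum running from level 5 + j to
  -- level 9 + j; the next stage is stage 6 + j. The walk dips if it meanwhile falls
  -- to level 1 + j, which the emitted bit reports.
  data Phase : Set where
    below fresh dipped : Phase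

  data Observation : Set where
    continue : Phase → Observation
    emit     : Bool → Observation

  data Observed (j : ℕ) (u : ℤ) : Phase → Observation → Set where
    enter : level (5 + j) ℤ.≤ u → Observed j u below (continue fresh)
    wait  : u ℤ.< level (5 + j) → Observed j u below (continue below)
    dip   : u ℤ.≤ level (1 + j) → Observed j u fresh (continue dipped)
    leave : level (9 + j) ℤ.≤ u → Observed j u fresh (emit false)
    roam  : level (1 + j) ℤ.< u → u ℤ.< level (9 + j) → Observed j u fresh (continue fresh)
    leave′ : level (9 + j) ℤ.≤ u → Observed j u dipped (emit true)
    roam′  : u ℤ.< level (9 + j) → Observed j u dipped (continue dipped)

  observe : ∀ ph j u → ∃ (Observed j u ph)
  observe below j u with level (5 + j) ℤₚ.≤? u
  ... | yes p = _ , enter p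
  ... | no ¬p = _ , wait (ℤₚ.≰⇒> ¬p)
  observe fresh j u with u ℤₚ.≤? level (1 + j) | level (9 + j) ℤₚ.≤? u
  ... | yes p | _     = _ , dip p
  ... | no ¬p | yes q = _ , leave q
  ... | no ¬p | no ¬q = _ , roam (ℤₚ.≰⇒> ¬p) (ℤₚ.≰⇒> ¬q)
  observe dipped j u with level (9 + j) ℤₚ.≤? u
  ... | yes p = _ , leave′ p
  ... | no ¬p = _ , roam′ (ℤₚ.≰⇒> ¬p)

  -- Stage j of the second token has its maximum running from level 4 + j to level 10 + j.
  -- If the first token dips, the second one must fall to level 2 + j on the way; if
  -- not, it must not fall to level j after reaching level 6 + j and before reaching level 8 + j.
  data Watch : Set where
    mustDip awaiting mustNotDip settled : ℕ → List Bool → Watch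
    dead : Watch

  expecting : ℕ → List Bool → Watch
  expecting j []           = settled j []
  expecting j (true  ∷ bs) = mustDip j bs
  expecting j (false ∷ bs) = awaiting j bs

  data Watched (v : ℤ) : Watch → Watch → Set where
    obey    : ∀ {j bs} → v ℤ.≤ level (2 + j) → Watched v (mustDip j bs) (settled j bs)
    miss    : ∀ {j bs} → level (10 + j) ℤ.≤ v → Watched v (mustDip j bs) dead
    linger  : ∀ {j bs} → level (2 + j) ℤ.< v → v ℤ.< level (10 + j) →
              Watched v (mustDip j bs) (mustDip j bs)
    start   : ∀ {j bs} → level (6 + j) ℤ.≤ v → Watched v (awaiting j bs) (mustNotDip j bs)
    idle    : ∀ {j bs} → v ℤ.< level (6 + j) → Watched v (awaiting j bs) (awaiting j bs)
    obey′   : ∀ {j bs} → level (8 + j) ℤ.≤ v → Watched v (mustNotDip j bs) (settled j bs)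
    miss′   : ∀ {j bs} → v ℤ.≤ level j → Watched v (mustNotDip j bs) dead
    linger′ : ∀ {j bs} → level j ℤ.< v → v ℤ.< level (8 + j) →
              Watched v (mustNotDip j bs) (mustNotDip j bs)
    rest    : ∀ {j} → Watched v (settled j []) (settled j [])
    finish  : ∀ {j b bs} → level (10 + j) ℤ.≤ v →
              Watched v (settled j (b ∷ bs)) (expecting (6 + j) (b ∷ bs))
    roam    : ∀ {j b bs} → v ℤ.< level (10 + j) →
              Watched v (settled j (b ∷ bs)) (settled j (b ∷ bs))
    dead    : Watched v dead dead

  watch : ∀ S v → ∃ (Watched v S)
  watch (mustDip j bs) v with v ℤₚ.≤? level (2 + j) | level (10 + j) ℤₚ.≤? v
  ... | yes p | _     = _ , obey p
  ... | no ¬p | yes q = _ , miss q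
  ... | no ¬p | no ¬q = _ , linger (ℤₚ.≰⇒> ¬p) (ℤₚ.≰⇒> ¬q)
  watch (awaiting j bs) v with level (6 + j) ℤₚ.≤? v
  ... | yes p = _ , start p
  ... | no ¬p = _ , idle (ℤₚ.≰⇒> ¬p)
  watch (mustNotDip j bs) v with level (8 + j) ℤₚ.≤? v | v ℤₚ.≤? level j
  ... | yes p | _     = _ , obey′ p
  ... | no ¬p | yes q = _ , miss′ q
  ... | no ¬p | no ¬q = _ , linger′ (ℤₚ.≰⇒> ¬q) (ℤₚ.≰⇒> ¬p)
  watch (settled j []) v = _ , rest
  watch (settled j (b ∷ bs)) v with level (10 + j) ℤₚ.≤? v
  ... | yes p = _ , finish p
  ... | no ¬p = _ , roam (ℤₚ.≰⇒> ¬p)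
  watch dead v = _ , dead

  InPhase : Phase → ℕ → ℤ → Set
  InPhase below  j u = u ℤ.< level (5 + j)
  InPhase fresh  j u = level (1 + j) ℤ.< u × u ℤ.< level (9 + j)
  InPhase dipped j u = u ℤ.< level (9 + j)

  InPhase-top : ∀ ph {j u} → InPhase ph j u → u ℤ.< level (9 + j)
  InPhase-top below  {j} u<   = ℤₚ.<-trans u< (level-< 3 (5 + j))
  InPhase-top fresh  (_ , u<) = u<
  InPhase-top dipped u<       = u<

  InWatch : Watch → ℤ → Set
  InWatch (mustDip j bs)       v = level (2 + j) ℤ.< v × v ℤ.< level (10 + j)
  InWatch (awaiting j bs)      v = v ℤ.< level (6 + j)
  InWatch (mustNotDip j bs)    v = level j ℤ.< v × v ℤ.< level (8 + j)
  InWatch (settled j [])       v = ⊤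
  InWatch (settled j (b ∷ bs)) v = v ℤ.< level (10 + j)
  InWatch dead                 v = ⊤

  InWatch-settled : ∀ {j v} bs → v ℤ.< level (10 + j) → InWatch (settled j bs) v
  InWatch-settled []       v< = tt
  InWatch-settled (b ∷ bs) v< = v<

  InWatch-expecting : ∀ {j v} bs → level (2 + j) ℤ.< v → v ℤ.< level (6 + j) → InWatch (expecting j bs) v
  InWatch-expecting     []           l< v< = tt
  InWatch-expecting {j} (true  ∷ bs) l< v< = l< , ℤₚ.<-trans v< (level-< 3 (6 + j))
  InWatch-expecting     (false ∷ bs) l< v< = v<

  Resumed : Observation → ℕ → ℤ → Set
  Resumed (continue ph) j u = InPhase ph j u
  Resumed (emit b)      j u = InPhase below (6 + j) u

  module _ (σ : Bool) where

    -- Unit steps meet a threshold exactly, so at the moment of crossing it the position is still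
    -- under the next level.
    observed-phase : ∀ {ph j u o} d → Observed j (move σ d u) ph o → InPhase ph j u →
                     Resumed o j (move σ d u)
    observed-phase {j = j} d (enter l≤) u< =
      ℤₚ.<-≤-trans (level-< 3 (1 + j)) l≤ , ℤₚ.≤-<-trans (move-≤ σ d u<) (level-< 3 (5 + j))
    observed-phase d (wait u<)     _        = u<
    observed-phase {j = j} d (dip u≤) _     = ℤₚ.≤-<-trans u≤ (level-< 7 (1 + j))
    observed-phase {j = j} d (leave _) (_ , u<) = ℤₚ.≤-<-trans (move-≤ σ d u<) (level-< 1 (9 + j))
    observed-phase d (roam l< u<)  _        = l< , u<
    observed-phase {j = j} d (leave′ _) u<  = ℤₚ.≤-<-trans (move-≤ σ d u<) (level-< 1 (9 + j))
    observed-phase d (roam′ u<)    _        = u<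

    watched-inWatch : ∀ {S S′ v} e → Watched (move σ e v) S S′ → InWatch S v →
                      InWatch S′ (move σ e v)
    watched-inWatch e (obey {j} {bs} v≤) _ =
      InWatch-settled bs (ℤₚ.≤-<-trans v≤ (level-< 7 (2 + j)))
    watched-inWatch e (miss _)        _  = tt
    watched-inWatch e (linger l< v<)  _  = l< , v<
    watched-inWatch e (start {j} l≤)  v< =
      ℤₚ.<-≤-trans (level-< 5 j) l≤ , ℤₚ.≤-<-trans (move-≤ σ e v<) (level-< 1 (6 + j))
    watched-inWatch e (idle v<)       _  = v<
    watched-inWatch e (obey′ {j} {bs} _) (_ , v<) =
      InWatch-settled bs (ℤₚ.≤-<-trans (move-≤ σ e v<) (level-< 1 (8 + j)))
    watched-inWatch e (miss′ _)       _  = tt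
    watched-inWatch e (linger′ l< v<) _  = l< , v<
    watched-inWatch e rest            _  = tt
    watched-inWatch e (finish {j} {b} {bs} l≤) v< =
      InWatch-expecting (b ∷ bs) (ℤₚ.<-≤-trans (level-< 1 (8 + j)) l≤)
                             (ℤₚ.≤-<-trans (move-≤ σ e v<) (level-< 1 (10 + j)))
    watched-inWatch e (roam v<)       _  = v<
    watched-inWatch e dead            _  = tt

    signature : Phase → ℕ → ℤ → List Bool → List Bool
    resume    : Observation → ℕ → ℤ → List Bool → List Bool
    signature ph j u []       = []
    signature ph j u (d ∷ ds) = resume (proj₁ (observe ph j (move σ d u))) j (move σ d u) ds
    resume (continue ph) j u ds = signature ph j u ds
    resume (emit b)      j u ds = b ∷ signature below (6 + j) u ds

    -- The `dipped` phase can end only by emitting `true`; this refutes a predicted 0 once the first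
    -- token has fallen.
    signature-dipped : ∀ {j bs} u ds → false ∷ bs ≢ signature dipped j u ds
    signature-dipped {j} u (d ∷ ds) eq with observe dipped j (move σ d u)
    signature-dipped {j} u (d ∷ ds) () | _ , leave′ _
    ... | _ , roam′ _ = signature-dipped _ ds eq

    -- Rejecting an outstanding demand at the end of the walk is sound: a bit is emitted only when
    -- the first token leaves its stage, and by then the second token has settled that demand.
    accepting : Watch → Bool
    accepting (settled j []) = true
    accepting _              = false

    accepts : Watch → ℤ → List Bool → Bool
    accepts S v []       = accepting S
    accepts S v (e ∷ es) = accepts (proj₁ (watch S (move σ e v))) (move σ e v) es

    accepts-settled : ∀ j v es → T (accepts (settled j []) v es)
    accepts-settled j v []       = tt
    accepts-settled j v (e ∷ es) = accepts-settled j (move σ e v) es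

    -- Coupling: nearby walks meet the demands

    data Track : ℤ → List Bool → ℤ → List Bool → Set where
      stop     : ∀ {u v} → Track u [] v []
      advance₁ : ∀ {u v d ds es} → Near (move σ d u) v →
                 Track (move σ d u) ds v es → Track u (d ∷ ds) v es
      advance₂ : ∀ {u v ds e es} → Near u (move σ e v) →
                 Track u ds (move σ e v) es → Track u ds v (e ∷ es)

    data Undipped : Phase → Set where
      below : Undipped below
      fresh : Undipped fresh

    -- The list is the future signature of the first token.
    data Coupled : Phase → ℕ → List Bool → Watch → Set where
      dip-ahead  : ∀ {ph j bs} → Undipped ph → Coupled ph j (true ∷ bs) (mustDip j bs)
      wait-ahead : ∀ {ph j bs} → Undipped ph → Coupled ph j (false ∷ bs) (awaiting j bs)
      no-dip     : ∀ {j bs} → Coupled fresh j (false ∷ bs) (mustNotDip j bs)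
      agreed     : ∀ {ph j b bs} → Coupled ph j (b ∷ bs) (settled j bs)
      lagging    : ∀ {j bs} → Coupled below (6 + j) bs (settled j bs)

    Coupled-expecting : ∀ j b bs → Coupled below j (b ∷ bs) (expecting j (b ∷ bs))
    Coupled-expecting j true  bs = dip-ahead below
    Coupled-expecting j false bs = wait-ahead below

    contradictory : ∀ {a} {A : Set a} {i j : ℤ} → i ℤ.< j → j ℤ.≤ i → A
    contradictory i<j j≤i = ⊥-elim (ℤₚ.<⇒≱ i<j j≤i)

    -- A simulation: each threshold crossed by one token either moves the coupling on or contradicts
    -- the position of the other token. Since the coupling carries the future bits, the second token
    -- can be judged before the first has emitted them.
    track⇒accepts : ∀ {ph j u ds v es bs S} → Track u ds v es →
      InPhase ph j u → InWatch S v → Coupled ph j bs S → bs ≡ signature ph j u ds →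
      T (accepts S v es)

    after-advance₁ : ∀ {ph j u ds v es bs S o} → Near u v → Track u ds v es →
      Observed j u ph o → Resumed o j u → InWatch S v → Coupled ph j bs S →
      bs ≡ resume o j u ds → T (accepts S v es)
    after-advance₁ nr tr (enter _) ip iw (dip-ahead _)  eq = track⇒accepts tr ip iw (dip-ahead fresh) eq
    after-advance₁ nr tr (enter _) ip iw (wait-ahead _) eq = track⇒accepts tr ip iw (wait-ahead fresh) eq
    after-advance₁ nr tr (enter _) ip iw agreed         eq = track⇒accepts tr ip iw agreed eq
    after-advance₁ {v = v} {es} nr tr (enter _) ip iw (lagging {j} {[]}) eq = accepts-settled j v es
    -- The next stage opens for the second token at level `10 + j`, one level before the first can
    -- enter it at `11 + j`.
    after-advance₁ nr tr (enter l≤) ip iw (lagging {j} {_ ∷ _}) eq =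
      contradictory iw (ℤₚ.<⇒≤ (near-above (10 + j) nr l≤))
    after-advance₁ nr tr (wait _) ip iw c eq = track⇒accepts tr ip iw c eq
    -- A dip of the first token to level `1 + j` puts the second below `2 + j`, where its demand
    -- would have been met already.
    after-advance₁ nr tr (dip u≤) ip iw (dip-ahead {j = j} _) eq =
      contradictory (near-below (1 + j) nr u≤) (ℤₚ.<⇒≤ (proj₁ iw))
    after-advance₁ {u = u} {ds} nr tr (dip _) ip iw (wait-ahead _) eq = ⊥-elim (signature-dipped u ds eq)
    after-advance₁ {u = u} {ds} nr tr (dip _) ip iw no-dip         eq = ⊥-elim (signature-dipped u ds eq)
    after-advance₁ nr tr (dip _) ip iw agreed eq = track⇒accepts tr ip iw agreed eq
    after-advance₁ nr tr (leave _) ip iw (dip-ahead _) ()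
    -- Here and in the next case the first token is at level `9 + j`, so the second is above
    -- `8 + j`, past the end of its shorter stage.
    after-advance₁ nr tr (leave l≤) ip iw (wait-ahead {j = j} _) eq =
      contradictory (ℤₚ.<-trans iw (level-< 1 (6 + j))) (ℤₚ.<⇒≤ (near-above (8 + j) nr l≤))
    after-advance₁ nr tr (leave l≤) ip iw (no-dip {j}) eq =
      contradictory (proj₂ iw) (ℤₚ.<⇒≤ (near-above (8 + j) nr l≤))
    after-advance₁ nr tr (leave _) ip iw agreed refl = track⇒accepts tr ip iw lagging refl
    after-advance₁ nr tr (roam _ _) ip iw c eq = track⇒accepts tr ip iw c eq
    after-advance₁ nr tr (leave′ _) ip iw agreed refl = track⇒accepts tr ip iw lagging refl
    after-advance₁ nr tr (roam′ _) ip iw c eq = track⇒accepts tr ip iw c eq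

    after-advance₂ : ∀ {ph j u ds v es bs S S′} → Near u v → Track u ds v es →
      Watched v S S′ → InPhase ph j u → InWatch S′ v → Coupled ph j bs S →
      bs ≡ signature ph j u ds → T (accepts S′ v es)
    after-advance₂ nr tr (obey _) ip iw (dip-ahead _) eq = track⇒accepts tr ip iw agreed eq
    -- Dually, the second token cannot exhaust its longer stage while the first is still under level
    -- `9 + j`.
    after-advance₂ {ph} nr tr (miss {j} l≤) ip iw (dip-ahead _) eq =
      contradictory (InPhase-top ph ip) (ℤₚ.<⇒≤ (near-above (9 + j) (Near-sym nr) l≤))
    after-advance₂ nr tr (linger _ _) ip iw c eq = track⇒accepts tr ip iw c eq
    after-advance₂ nr tr (start {j} l≤) ip iw (wait-ahead below) eq =
      contradictory ip (ℤₚ.<⇒≤ (near-above (5 + j) (Near-sym nr) l≤))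
    after-advance₂ nr tr (start _) ip iw (wait-ahead fresh) eq = track⇒accepts tr ip iw no-dip eq
    after-advance₂ nr tr (idle _) ip iw c eq = track⇒accepts tr ip iw c eq
    after-advance₂ nr tr (obey′ _) ip iw no-dip eq = track⇒accepts tr ip iw agreed eq
    after-advance₂ nr tr (miss′ {j} v≤) ip iw no-dip eq =
      contradictory (near-below j (Near-sym nr) v≤) (ℤₚ.<⇒≤ (proj₁ ip))
    after-advance₂ nr tr (linger′ _ _) ip iw c eq = track⇒accepts tr ip iw c eq
    after-advance₂ nr tr rest ip iw c eq = track⇒accepts tr ip iw c eq
    after-advance₂ {ph} nr tr (finish {j} l≤) ip iw agreed eq =
      contradictory (InPhase-top ph ip) (ℤₚ.<⇒≤ (near-above (9 + j) (Near-sym nr) l≤))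
    after-advance₂ nr tr (finish {j} {b} {bs} _) ip iw lagging eq =
      track⇒accepts tr ip iw (Coupled-expecting (6 + j) b bs) eq
    after-advance₂ nr tr (roam _) ip iw c eq = track⇒accepts tr ip iw c eq

    -- With the first word exhausted no bit is to come, and `lagging` is the only coupling that
    -- allows an empty future.
    track⇒accepts stop ip iw (lagging) refl = tt
    track⇒accepts {ph} {j} (advance₁ {u} {d = d} nr tr) ip iw c eq =
      after-advance₁ nr tr o (observed-phase d o ip) iw c eq
      where o = proj₂ (observe ph j (move σ d u))
    track⇒accepts {S = S} (advance₂ {v = v} {e = e} nr tr) ip iw c eq =
      after-advance₂ nr tr w ip (watched-inWatch e w iw) c eq
      where w = proj₂ (watch S (move σ e v))

-- From schedules to tracks, in both orientations of the lift

Ahead : Bool → ℕ → ℤ → ℤ → Set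
Ahead true  d u v = u ≡ ℤ.+ d ℤ.+ v
Ahead false d u v = v ≡ ℤ.+ d ℤ.+ u

private
  suc-left : ∀ d u v → u ≡ ℤ.+ d ℤ.+ v → ℤ.suc u ≡ ℤ.+ suc d ℤ.+ v
  suc-left d _ v refl = sym (ℤₚ.suc-+ d v)

  pred-left : ∀ d u v → u ≡ ℤ.+ suc d ℤ.+ v → ℤ.pred u ≡ ℤ.+ d ℤ.+ v
  pred-left d _ v refl = trans (cong ℤ.pred (ℤₚ.suc-+ d v)) (ℤₚ.pred-suc _)

  suc-right : ∀ d u v → u ≡ ℤ.+ suc d ℤ.+ v → u ≡ ℤ.+ d ℤ.+ ℤ.suc v
  suc-right d _ v refl = shift (ℤ.+ d) v
    where
    shift : ∀ a v → (ℤ.1ℤ ℤ.+ a) ℤ.+ v ≡ a ℤ.+ (ℤ.1ℤ ℤ.+ v)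
    shift = ℤ-Solver.solve-∀

  pred-right : ∀ d u v → u ≡ ℤ.+ d ℤ.+ v → u ≡ ℤ.+ suc d ℤ.+ ℤ.pred v
  pred-right d _ v refl = shift (ℤ.+ d) v
    where
    shift : ∀ a v → a ℤ.+ v ≡ (ℤ.1ℤ ℤ.+ a) ℤ.+ (ℤ.-1ℤ ℤ.+ v)
    shift = ℤ-Solver.solve-∀

Ahead-forth₁ : ∀ σ d u v → Ahead σ d u v → Ahead σ (suc d) (move σ true u) v
Ahead-forth₁ true  d u v = suc-left d u v
Ahead-forth₁ false d u v = pred-right d v u

Ahead-back₁ : ∀ σ d u v → Ahead σ (suc d) u v → Ahead σ d (move σ false u) v
Ahead-back₁ true  d u v = pred-left d u v
Ahead-back₁ false d u v = suc-right d v u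

Ahead-forth₂ : ∀ σ d u v → Ahead σ (suc d) u v → Ahead σ d u (move σ true v)
Ahead-forth₂ true  d u v = suc-right d u v
Ahead-forth₂ false d u v = pred-left d v u

Ahead-back₂ : ∀ σ d u v → Ahead σ d u v → Ahead σ (suc d) u (move σ false v)
Ahead-back₂ true  d u v = pred-right d u v
Ahead-back₂ false d u v = suc-left d v u

data Reaches (σ : Bool) (t : ℤ) : ℤ → List Bool → Set where
  now   : ∀ {u ds} → t ℤ.≤ u → Reaches σ t u ds
  later : ∀ {u d ds} → Reaches σ t (move σ d u) ds → Reaches σ t u (d ∷ ds)

module _ (n : ℕ) .{{_ : NonZero n}} where

  private
    ahead⇒near : ∀ d u v → d < n → u ≡ ℤ.+ d ℤ.+ v → Near n u v
    ahead⇒near d _ v d<n refl =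
      ℤₚ.+-monoˡ-< v (ℤ.+<+ d<n) , ℤₚ.≤-<-trans (ℤₚ.i≤j+i v (ℤ.+ d)) (i<n+i n _)

  Ahead⇒Near : ∀ σ d u v → d < n → Ahead σ d u v → Near n u v
  Ahead⇒Near true  d u v d<n a = ahead⇒near d u v d<n a
  Ahead⇒Near false d u v d<n a = Near-sym n (ahead⇒near d v u d<n a)

  schedule⇒track : ∀ σ {d ds es} u v → Schedule n d ds es → d < n → Ahead σ d u v →
                   Track n σ u ds v es
  schedule⇒track σ u v stop d<n a = stop
  schedule⇒track σ {d} u v (forth₁ d+1<n s) d<n a =
    advance₁ (Ahead⇒Near σ (suc d) _ v d+1<n a′) (schedule⇒track σ _ v s d+1<n a′)
    where a′ = Ahead-forth₁ σ d u v a
  schedule⇒track σ u v (back₁ {d} s) d+1<n a =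
    advance₁ (Ahead⇒Near σ d _ v d<n a′) (schedule⇒track σ _ v s d<n a′)
    where
    a′ = Ahead-back₁ σ d u v a
    d<n = <-trans (n<1+n d) d+1<n
  schedule⇒track σ u v (forth₂ {d} s) d+1<n a =
    advance₂ (Ahead⇒Near σ d u _ d<n a′) (schedule⇒track σ u _ s d<n a′)
    where
    a′ = Ahead-forth₂ σ d u v a
    d<n = <-trans (n<1+n d) d+1<n
  schedule⇒track σ {d} u v (back₂ d+1<n s) d<n a =
    advance₂ (Ahead⇒Near σ (suc d) u _ d+1<n a′) (schedule⇒track σ u _ s d+1<n a′)
    where a′ = Ahead-back₂ σ d u v a

  -- Stages completed by a climb

  stageEnd : ℕ → ℕ → ℕ
  -- The last of `K` stages is left at level 9 + 6 (K - 1) + j = 3 + 6 K + j; the base case is this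
  -- formula at `K = 0`.
  stageEnd zero    j = 3 + j
  stageEnd (suc K) j = stageEnd K (6 + j)

  3+j≤stageEnd : ∀ K j → 3 + j ≤ stageEnd K j
  3+j≤stageEnd zero    j = ≤-refl
  3+j≤stageEnd (suc K) j = ≤-trans (m≤n+m (3 + j) 6) (3+j≤stageEnd K (6 + j))

  stageEnd-* : ∀ K j → stageEnd K j ≡ 3 + (K * 6 + j)
  stageEnd-* zero    j = refl
  stageEnd-* (suc K) j = trans (stageEnd-* K (6 + j)) (cong (3 +_) (shift (K * 6) j))
    where
    shift : ∀ a j → a + (6 + j) ≡ 6 + a + j
    shift a j = trans (sym (+-assoc a 6 j)) (cong (_+ j) (+-comm a 6))

  reaches⇒long-signature : ∀ σ K {ph j u ds} → InPhase n ph j u →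
    Reaches σ (level n (stageEnd K j)) u ds → K ≤ length (signature n σ ph j u ds)
  reaches⇒long-signature σ zero    ip r = z≤n
  reaches⇒long-signature σ (suc K) {ph} {j} ip (now l≤u) = ⊥-elim (ℤₚ.<⇒≱ (InPhase-top n ph ip)
    (ℤₚ.≤-trans (level-mono n (3+j≤stageEnd K (6 + j))) l≤u))
  reaches⇒long-signature σ (suc K) {ph} {j} {u} ip (later {d = d} r)
    with observe n ph j (move σ d u)
  ... | continue ph′ , o = reaches⇒long-signature σ (suc K) (observed-phase n σ d o ip) r
  ... | emit b       , o = s≤s (reaches⇒long-signature σ K (observed-phase n σ d o ip) r)

  -- Gambler's ruin for the second walk

  private
    scale : ℤ
    scale = level n 8

  -- 8n times the probability of meeting the demand of the current stage.
  value : Watch n → ℤ → ℤ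
  value (mustDip j bs)    v = level n (10 + j) ℤ.- v
  value (awaiting j bs)   v = level n 6
  value (mustNotDip j bs) v = v ℤ.- level n j
  value (settled j bs)    v = scale
  value dead              v = ℤ.0ℤ

  -- The current stage is not counted, because its chance is already in `value`.
  remaining : Watch n → ℕ
  remaining (mustDip j bs)    = length bs
  remaining (awaiting j bs)   = length bs
  remaining (mustNotDip j bs) = length bs
  remaining (settled j bs)    = length bs
  remaining dead              = 0

  value-nonneg : ∀ S {v} → InWatch n S v → ℤ.0ℤ ℤ.≤ value S v
  value-nonneg (mustDip j bs)    (_ , v<) = ℤₚ.i≤j⇒0≤j-i (ℤₚ.<⇒≤ v<)
  value-nonneg (awaiting j bs)   _        = level-mono n {0} {6} z≤n
  value-nonneg (mustNotDip j bs) (l< , _) = ℤₚ.i≤j⇒0≤j-i (ℤₚ.<⇒≤ l<)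
  value-nonneg (settled j bs)    _        = level-mono n {0} {8} z≤n
  value-nonneg dead              _        = ℤₚ.≤-refl

  -- Each `value` is affine in the position, hence harmonic for the walk. Inequalities enter only at
  -- changes of state and at the end of the word.
  value-average : ∀ σ S v → value S (move σ true v) ℤ.+ value S (move σ false v) ≡
                            ℤ.+ 2 ℤ.* value S v
  value-average σ S v = go σ S
    where
    double : ∀ c → c ℤ.+ c ≡ ℤ.+ 2 ℤ.* c
    double = ℤ-Solver.solve-∀
    e₁ : ∀ l v → (l ℤ.- (ℤ.1ℤ ℤ.+ v)) ℤ.+ (l ℤ.- (ℤ.-1ℤ ℤ.+ v)) ≡ ℤ.+ 2 ℤ.* (l ℤ.- v)
    e₁ = ℤ-Solver.solve-∀
    e₂ : ∀ l v → (l ℤ.- (ℤ.-1ℤ ℤ.+ v)) ℤ.+ (l ℤ.- (ℤ.1ℤ ℤ.+ v)) ≡ ℤ.+ 2 ℤ.* (l ℤ.- v)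
    e₂ = ℤ-Solver.solve-∀
    e₃ : ∀ l v → ((ℤ.1ℤ ℤ.+ v) ℤ.- l) ℤ.+ ((ℤ.-1ℤ ℤ.+ v) ℤ.- l) ≡ ℤ.+ 2 ℤ.* (v ℤ.- l)
    e₃ = ℤ-Solver.solve-∀
    e₄ : ∀ l v → ((ℤ.-1ℤ ℤ.+ v) ℤ.- l) ℤ.+ ((ℤ.1ℤ ℤ.+ v) ℤ.- l) ≡ ℤ.+ 2 ℤ.* (v ℤ.- l)
    e₄ = ℤ-Solver.solve-∀
    go : ∀ σ S → value S (move σ true v) ℤ.+ value S (move σ false v) ≡ ℤ.+ 2 ℤ.* value S v
    go true  (mustDip j bs)    = e₁ (level n (10 + j)) v
    go false (mustDip j bs)    = e₂ (level n (10 + j)) v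
    go true  (mustNotDip j bs) = e₃ (level n j) v
    go false (mustNotDip j bs) = e₄ (level n j) v
    go σ     (awaiting j bs)   = double (level n 6)
    go σ     (settled j bs)    = double scale
    go σ     dead              = refl

  private
    ≤-by-diff : ∀ {a b c d} → a ℤ.≤ b → b ℤ.- a ≡ d ℤ.- c → c ℤ.≤ d
    ≤-by-diff a≤b eq = ℤₚ.0≤i-j⇒j≤i (subst (ℤ.0ℤ ℤ.≤_) eq (ℤₚ.i≤j⇒0≤j-i a≤b))

  -- At level `4 + j` a required dip succeeds with 6 of 8 parts, and starting higher only makes it
  -- less likely. A forbidden dip is given its 6 parts in advance, while awaiting level `6 + j`.
  value-expecting : ∀ {j v} b bs → level n (4 + j) ℤ.≤ v → value (expecting n j (b ∷ bs)) v ℤ.≤ level n 6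
  value-expecting {j} {v} true bs l≤v = ≤-by-diff l≤v (eq (ℤ.+ n) (level n j) v)
    where
    eq : ∀ ν l v → v ℤ.- (ν ℤ.+ (ν ℤ.+ (ν ℤ.+ (ν ℤ.+ l)))) ≡
      (ν ℤ.+ (ν ℤ.+ (ν ℤ.+ (ν ℤ.+ (ν ℤ.+ (ν ℤ.+ ℤ.0ℤ)))))) ℤ.-
      ((ν ℤ.+ (ν ℤ.+ (ν ℤ.+ (ν ℤ.+ (ν ℤ.+ (ν ℤ.+ (ν ℤ.+ (ν ℤ.+ (ν ℤ.+ (ν ℤ.+ l)))))))))) ℤ.- v)
    eq = ℤ-Solver.solve-∀
  value-expecting false bs l≤v = ℤₚ.≤-refl

  private
    -- The inequality m / 2^N ≤ (3/4)^r · x / 8n with the denominators cleared.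
    bound : (r : ℕ) (x : ℤ) (N m : ℕ) → Set
    bound r x N m = ℤ.+ (4 ^ r) ℤ.* scale ℤ.* ℤ.+ m ℤ.≤ ℤ.+ (2 ^ N) ℤ.* ℤ.+ (3 ^ r) ℤ.* x

    nonNeg-* : ∀ a b → ℤ.NonNegative (ℤ.+ a ℤ.* ℤ.+ b)
    nonNeg-* a b = ℤ.nonNegative (subst (ℤ.0ℤ ℤ.≤_) (ℤₚ.pos-* a b) (ℤ.+≤+ z≤n))

    bound-weaken : ∀ r {x y} N m → x ℤ.≤ y → bound r x N m → bound r y N m
    bound-weaken r N m x≤y b = ℤₚ.≤-trans b
      (ℤₚ.*-monoˡ-≤-nonNeg (ℤ.+ (2 ^ N) ℤ.* ℤ.+ (3 ^ r)) {{nonNeg-* (2 ^ N) (3 ^ r)}} x≤y)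

    bound-zero : ∀ r {x} N → ℤ.0ℤ ℤ.≤ x → bound r x N 0
    bound-zero r N 0≤x = bound-weaken r N 0 0≤x (ℤₚ.≤-reflexive
      (trans (ℤₚ.*-zeroʳ (ℤ.+ (4 ^ r) ℤ.* scale))
             (sym (ℤₚ.*-zeroʳ (ℤ.+ (2 ^ N) ℤ.* ℤ.+ (3 ^ r))))))

    -- This is where each factor 3/4 arises, from 6n = (3/4) · 8n at the opening of a stage.
    bound-stage : ∀ r N m → bound r (level n 6) N m → bound (suc r) scale N m
    bound-stage r N m b = subst₂ ℤ._≤_ (lhs (ℤ.+ (4 ^ r)) (ℤ.+ (4 ^ suc r)) scale (ℤ.+ m) (ℤₚ.pos-* 4 (4 ^ r)))
      (rhs (ℤ.+ (2 ^ N)) (ℤ.+ (3 ^ r)) (ℤ.+ (3 ^ suc r)) (ℤ.+ n) (ℤₚ.pos-* 3 (3 ^ r)))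
      (ℤₚ.*-monoˡ-≤-nonNeg (ℤ.+ 4) b)
      where
      lhs′ : ∀ a s m → ℤ.+ 4 ℤ.* (a ℤ.* s ℤ.* m) ≡ (ℤ.+ 4 ℤ.* a) ℤ.* s ℤ.* m
      lhs′ = ℤ-Solver.solve-∀
      lhs : ∀ a a′ s m → a′ ≡ ℤ.+ 4 ℤ.* a → ℤ.+ 4 ℤ.* (a ℤ.* s ℤ.* m) ≡ a′ ℤ.* s ℤ.* m
      lhs a _ s m refl = lhs′ a s m
      rhs′ : ∀ p q ν →
        ℤ.+ 4 ℤ.* (p ℤ.* q ℤ.* (ν ℤ.+ (ν ℤ.+ (ν ℤ.+ (ν ℤ.+ (ν ℤ.+ (ν ℤ.+ ℤ.0ℤ))))))) ≡
        p ℤ.* (ℤ.+ 3 ℤ.* q) ℤ.*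
          (ν ℤ.+ (ν ℤ.+ (ν ℤ.+ (ν ℤ.+ (ν ℤ.+ (ν ℤ.+ (ν ℤ.+ (ν ℤ.+ ℤ.0ℤ))))))))
      rhs′ = ℤ-Solver.solve-∀
      rhs : ∀ p q q′ ν → q′ ≡ ℤ.+ 3 ℤ.* q →
        ℤ.+ 4 ℤ.* (p ℤ.* q ℤ.* (ν ℤ.+ (ν ℤ.+ (ν ℤ.+ (ν ℤ.+ (ν ℤ.+ (ν ℤ.+ ℤ.0ℤ))))))) ≡
        p ℤ.* q′ ℤ.*
          (ν ℤ.+ (ν ℤ.+ (ν ℤ.+ (ν ℤ.+ (ν ℤ.+ (ν ℤ.+ (ν ℤ.+ (ν ℤ.+ ℤ.0ℤ))))))))
      rhs p q _ ν refl = rhs′ p q ν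

  module _ (σ : Bool) where

    accepted : Watch n → ℤ → ℕ → ℕ
    accepted S v N = wordSum (indicator ∘ accepts n σ S v) N

    accepted-dead : ∀ v N → accepted dead v N ≡ 0
    accepted-dead v zero    = refl
    accepted-dead v (suc N) = cong₂ _+_ (accepted-dead _ N) (accepted-dead _ N)

    private
      -- Boundary comparison of the game. On success the old `value` is at least `scale`; on failure
      -- nothing is accepted, so that a nonnegative old `value` is enough.
      arrive : ∀ {S S′ v} e N → InWatch n S v → Watched n (move σ e v) S S′ →
        bound (remaining S′) (value S′ (move σ e v)) N (accepted S′ (move σ e v) N) →
        bound (remaining S) (value S (move σ e v)) N (accepted S′ (move σ e v) N)
      arrive {v = v} e N iw (obey {j} {bs} v≤) b =
        bound-weaken (length bs) N _ (≤-by-diff v≤ (eq (ℤ.+ n) (level n j) (move σ e v))) b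
        where
        eq : ∀ ν l v → (ν ℤ.+ (ν ℤ.+ l)) ℤ.- v ≡
          ((ν ℤ.+ (ν ℤ.+ (ν ℤ.+ (ν ℤ.+ (ν ℤ.+ (ν ℤ.+ (ν ℤ.+ (ν ℤ.+ (ν ℤ.+ (ν ℤ.+ l)))))))))) ℤ.- v) ℤ.-
          (ν ℤ.+ (ν ℤ.+ (ν ℤ.+ (ν ℤ.+ (ν ℤ.+ (ν ℤ.+ (ν ℤ.+ (ν ℤ.+ ℤ.0ℤ))))))))
        eq = ℤ-Solver.solve-∀
      -- A unit step does not overshoot level `10 + j`, so the old value has not become negative.
      arrive {v = v} e N iw (miss {j} {bs} _) b =
        subst (bound (length bs) (level n (10 + j) ℤ.- move σ e v) N) (sym (accepted-dead (move σ e v) N))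
          (bound-zero (length bs) N (ℤₚ.i≤j⇒0≤j-i (move-≤ σ e (proj₂ iw))))
      arrive e N iw (linger _ _) b = b
      arrive {v = v} e N iw (start {j} {bs} _) b =
        bound-weaken (length bs) N _ (≤-by-diff (move-≤ σ e iw) (eq (ℤ.+ n) (level n j) (move σ e v))) b
        where
        eq : ∀ ν l v → (ν ℤ.+ (ν ℤ.+ (ν ℤ.+ (ν ℤ.+ (ν ℤ.+ (ν ℤ.+ l)))))) ℤ.- v ≡
          (ν ℤ.+ (ν ℤ.+ (ν ℤ.+ (ν ℤ.+ (ν ℤ.+ (ν ℤ.+ ℤ.0ℤ)))))) ℤ.- (v ℤ.- l)
        eq = ℤ-Solver.solve-∀
      arrive e N iw (idle _) b = b
      arrive {v = v} e N iw (obey′ {j} {bs} l≤) b =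
        bound-weaken (length bs) N _ (≤-by-diff l≤ (eq (ℤ.+ n) (level n j) (move σ e v))) b
        where
        eq : ∀ ν l v → v ℤ.- (ν ℤ.+ (ν ℤ.+ (ν ℤ.+ (ν ℤ.+ (ν ℤ.+ (ν ℤ.+ (ν ℤ.+ (ν ℤ.+ l)))))))) ≡
          (v ℤ.- l) ℤ.-
          (ν ℤ.+ (ν ℤ.+ (ν ℤ.+ (ν ℤ.+ (ν ℤ.+ (ν ℤ.+ (ν ℤ.+ (ν ℤ.+ ℤ.0ℤ))))))))
        eq = ℤ-Solver.solve-∀
      arrive {v = v} e N iw (miss′ {j} {bs} _) b =
        subst (bound (length bs) (move σ e v ℤ.- level n j) N) (sym (accepted-dead (move σ e v) N))
          (bound-zero (length bs) N (ℤₚ.i≤j⇒0≤j-i (move-≥ σ e (proj₁ iw))))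
      arrive e N iw (linger′ _ _) b = b
      arrive e N iw rest b = b
      arrive {v = v} e N iw (finish {j} {b = true} {bs} l≤) b =
        bound-stage (length bs) N _
          (bound-weaken (length bs) N (accepted (mustDip (6 + j) bs) (move σ e v) N)
            (value-expecting {6 + j} {move σ e v} true bs l≤) b)
      arrive {v = v} e N iw (finish {j} {b = false} {bs} l≤) b =
        bound-stage (length bs) N _ b
      arrive e N iw (roam _) b = b
      arrive e N iw dead b = b

    accepted-bound : ∀ N S v → InWatch n S v →
      bound (remaining S) (value S v) N (accepted S v N)
    accepted-bound zero (settled j []) v iw = ℤₚ.≤-reflexive (ℤₚ.*-identityʳ _)
    accepted-bound zero (settled j (x ∷ bs)) v iw =
      bound-zero (length (x ∷ bs)) 0 (value-nonneg (settled j (x ∷ bs)) iw)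
    accepted-bound zero (mustDip j bs) v iw = bound-zero (length bs) 0 (value-nonneg (mustDip j bs) iw)
    accepted-bound zero (awaiting j bs) v iw = bound-zero (length bs) 0 (value-nonneg (awaiting j bs) iw)
    accepted-bound zero (mustNotDip j bs) v iw = bound-zero (length bs) 0 (value-nonneg (mustNotDip j bs) iw)
    accepted-bound zero dead v iw = bound-zero 0 0 (value-nonneg dead {v} iw)
    accepted-bound (suc N) S v iw =
      combine (ℤ.+ (4 ^ remaining S) ℤ.* scale) (ℤ.+ (3 ^ remaining S)) (value-average σ S v)
        (next true) (next false)
      where
      next : ∀ e → bound (remaining S) (value S (move σ e v)) N
                     (accepted (proj₁ (watch n S (move σ e v))) (move σ e v) N)
      next e = arrive e N iw w (accepted-bound N _ _ (watched-inWatch n σ e w iw))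
        where w = proj₂ (watch n S (move σ e v))
      combine : ∀ c q {x y z m k} → x ℤ.+ y ≡ ℤ.+ 2 ℤ.* z →
        c ℤ.* ℤ.+ m ℤ.≤ ℤ.+ (2 ^ N) ℤ.* q ℤ.* x → c ℤ.* ℤ.+ k ℤ.≤ ℤ.+ (2 ^ N) ℤ.* q ℤ.* y →
        c ℤ.* ℤ.+ (m + k) ℤ.≤ ℤ.+ (2 ^ suc N) ℤ.* q ℤ.* z
      combine c q {x} {y} {z} {m} {k} eq p₁ p₂ = subst₂ ℤ._≤_
        (trans (sym (ℤₚ.*-distribˡ-+ c (ℤ.+ m) (ℤ.+ k))) (cong (c ℤ.*_) (sym (ℤₚ.pos-+ m k))))
        (trans (sym (ℤₚ.*-distribˡ-+ (ℤ.+ (2 ^ N) ℤ.* q) x y))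
          (trans (cong (ℤ.+ (2 ^ N) ℤ.* q ℤ.*_) eq)
            (trans (regroup (ℤ.+ (2 ^ N)) q z) (cong (λ p → p ℤ.* q ℤ.* z) (sym (ℤₚ.pos-* 2 (2 ^ N)))))))
        (ℤₚ.+-mono-≤ p₁ p₂)
        where
        regroup : ∀ p q z → p ℤ.* q ℤ.* (ℤ.+ 2 ℤ.* z) ≡ ℤ.+ 2 ℤ.* p ℤ.* q ℤ.* z
        regroup = ℤ-Solver.solve-∀

    few-accepted : ∀ bs N →
      4 ^ length bs * accepted (expecting n 0 bs) (level n 4) N ≤ 2 ^ N * 3 ^ length bs
    few-accepted bs N = ℤₚ.drop‿+≤+ (ℤₚ.*-cancelʳ-≤-pos _ _ scale (subst₂ ℤ._≤_
      (trans (swap (ℤ.+ (4 ^ length bs)) scale (ℤ.+ m))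
             (cong (ℤ._* scale) (sym (ℤₚ.pos-* (4 ^ length bs) m))))
      (cong (ℤ._* scale) (sym (ℤₚ.pos-* (2 ^ N) (3 ^ length bs))))
      (from-start bs)))
      where
      m = accepted (expecting n 0 bs) (level n 4) N
      instance
        scale-pos : ℤ.Positive scale
        scale-pos = ℤ.positive (level-< n 7 0)
      swap : ∀ a s m → a ℤ.* s ℤ.* m ≡ a ℤ.* m ℤ.* s
      swap = ℤ-Solver.solve-∀
      from-start : ∀ bs → bound (length bs) scale N (accepted (expecting n 0 bs) (level n 4) N)
      run : ∀ bs → bound (remaining (expecting n 0 bs)) (value (expecting n 0 bs) (level n 4)) N
                         (accepted (expecting n 0 bs) (level n 4) N)
      run bs = accepted-bound N (expecting n 0 bs) (level n 4)
                 (InWatch-expecting n bs (level-< n 1 2) (level-< n 1 4))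
      from-start [] = run []
      from-start (true ∷ bs) = bound-stage (length bs) N _
        (bound-weaken (length bs) N _ (value-expecting {0} true bs ℤₚ.≤-refl) (run (true ∷ bs)))
      from-start (false ∷ bs) = bound-stage (length bs) N _ (run (false ∷ bs))

-- Confinement of the first walk

module _ (L : ℕ) where

  Inside : ℤ → Set
  Inside x = ℤ.- ℤ.+ L ℤ.< x × x ℤ.< ℤ.+ L

  inside? : ∀ x → Dec (Inside x)
  inside? x = ℤ.- ℤ.+ L ℤₚ.<? x ×-dec x ℤₚ.<? ℤ.+ L

  confined : ℤ → List Bool → Bool
  confined x []       = ⌊ inside? x ⌋
  confined x (d ∷ ds) = ⌊ inside? x ⌋ ∧ confined (move true d x) ds

  private
    L² Q : ℤ
    L² = ℤ.+ L ℤ.* ℤ.+ L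
    Q  = ℤ.+ 2 ℤ.* L²

    -- With `Q` equal to twice `L²` the height stays between `L²` and `2L²` on the interval, so it
    -- is comparable to a constant there and dominates survival at time 0.
    height : ℤ → ℤ
    height x = Q ℤ.- x ℤ.* x

    -- Closed, unlike `Inside`: a step from inside may land on an endpoint, and the induction must
    -- apply there.
    Within : ℤ → Set
    Within x = ℤ.- ℤ.+ L ℤ.≤ x × x ℤ.≤ ℤ.+ L

    *-nonneg : ∀ {i j} → ℤ.0ℤ ℤ.≤ i → ℤ.0ℤ ℤ.≤ j → ℤ.0ℤ ℤ.≤ i ℤ.* j
    *-nonneg {i} {j} 0≤i 0≤j = subst (ℤ._≤ i ℤ.* j) (ℤₚ.*-zeroʳ i)
      (ℤₚ.*-monoˡ-≤-nonNeg i {{ℤ.nonNegative 0≤i}} 0≤j)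

    square-nonneg : ∀ x → ℤ.0ℤ ℤ.≤ x ℤ.* x
    square-nonneg (ℤ.+ x)    = *-nonneg {ℤ.+ x} {ℤ.+ x} (ℤ.+≤+ z≤n) (ℤ.+≤+ z≤n)
    square-nonneg ℤ.-[1+ x ] = ℤ.+≤+ z≤n

    height≤Q : ∀ x → height x ℤ.≤ Q
    height≤Q x = subst (height x ℤ.≤_) (ℤₚ.+-identityʳ Q)
      (ℤₚ.+-monoʳ-≤ Q (ℤₚ.neg-mono-≤ (square-nonneg x)))

    L²≤height : ∀ x → Within x → L² ℤ.≤ height x
    L²≤height x (-L≤x , x≤L) = ℤₚ.0≤i-j⇒j≤i (subst (ℤ.0ℤ ℤ.≤_) (eq (ℤ.+ L) x)
      (*-nonneg (ℤₚ.i≤j⇒0≤j-i -L≤x) (ℤₚ.i≤j⇒0≤j-i x≤L)))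
      where
      eq : ∀ l x → (x ℤ.- ℤ.- l) ℤ.* (l ℤ.- x) ≡ (ℤ.+ 2 ℤ.* (l ℤ.* l) ℤ.- x ℤ.* x) ℤ.- l ℤ.* l
      eq = ℤ-Solver.solve-∀

    0≤L² : ℤ.0ℤ ℤ.≤ L²
    0≤L² = square-nonneg (ℤ.+ L)

    survivors : ℤ → ℕ → ℕ
    survivors x N = wordSum (indicator ∘ confined x) N

    pow : ℤ → ℕ → ℤ
    pow b zero    = ℤ.1ℤ
    pow b (suc N) = b ℤ.* pow b N

    pow-nonneg : ∀ {b} → ℤ.0ℤ ℤ.≤ b → ∀ N → ℤ.0ℤ ℤ.≤ pow b N
    pow-nonneg 0≤b zero    = ℤ.+≤+ z≤n
    pow-nonneg 0≤b (suc N) = *-nonneg 0≤b (pow-nonneg 0≤b N)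

    shrink : ℤ
    shrink = ℤ.+ 2 ℤ.* (Q ℤ.- ℤ.1ℤ)

    0≤Q : ℤ.0ℤ ℤ.≤ Q
    0≤Q = *-nonneg {ℤ.+ 2} (ℤ.+≤+ z≤n) 0≤L²

    -- The height averages to height x − 1 ≤ (1 − 1/Q) height x over a step.
    survivors-bound : ℤ.0ℤ ℤ.≤ shrink → ∀ N x → Within x →
      pow Q N ℤ.* L² ℤ.* ℤ.+ survivors x N ℤ.≤ pow shrink N ℤ.* height x
    survivors-bound 0≤s zero x w with inside? x
    ... | yes _ = subst₂ ℤ._≤_ (eq L²) (sym (ℤₚ.*-identityˡ (height x))) (L²≤height x w)
      where
      eq : ∀ l → l ≡ ℤ.1ℤ ℤ.* l ℤ.* ℤ.1ℤ
      eq = ℤ-Solver.solve-∀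
    ... | no  _ = subst₂ ℤ._≤_ (sym (ℤₚ.*-zeroʳ (ℤ.1ℤ ℤ.* L²))) (sym (ℤₚ.*-identityˡ (height x)))
                    (ℤₚ.≤-trans 0≤L² (L²≤height x w))
    survivors-bound 0≤s (suc N) x w with inside? x
    ... | no _ = subst (ℤ._≤ pow shrink (suc N) ℤ.* height x)
      (sym (trans (cong (λ m → pow Q (suc N) ℤ.* L² ℤ.* ℤ.+ m) none) (ℤₚ.*-zeroʳ (pow Q (suc N) ℤ.* L²))))
      (*-nonneg (pow-nonneg 0≤s (suc N)) (ℤₚ.≤-trans 0≤L² (L²≤height x w)))
      where
      none : wordSum (λ _ → 0) N + wordSum (λ _ → 0) N ≡ 0
      none rewrite wordSum-const 0 N | *-zeroʳ (2 ^ N) = refl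
    ... | yes (l<x , x<l) = ℤₚ.≤-trans
      (subst₂ ℤ._≤_
        (trans (collect Q (pow Q N) L² (ℤ.+ m) (ℤ.+ k)) (cong (pow Q (suc N) ℤ.* L² ℤ.*_) (sym (ℤₚ.pos-+ m k))))
        (factor Q (pow shrink N) (height (ℤ.suc x)) (height (ℤ.pred x)))
        (ℤₚ.*-monoˡ-≤-nonNeg Q {{ℤ.nonNegative 0≤Q}} (ℤₚ.+-mono-≤ (step true) (step false))))
      (ℤₚ.0≤i-j⇒j≤i (subst (ℤ.0ℤ ℤ.≤_) (gain Q (pow shrink N) x)
        (*-nonneg (pow-nonneg 0≤s N)
          (*-nonneg {ℤ.+ 2} (ℤ.+≤+ z≤n) (ℤₚ.i≤j⇒0≤j-i (height≤Q x))))))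
      where
      m = survivors (ℤ.suc x) N
      k = survivors (ℤ.pred x) N
      step : ∀ d → pow Q N ℤ.* L² ℤ.* ℤ.+ survivors (move true d x) N ℤ.≤
                   pow shrink N ℤ.* height (move true d x)
      step d = survivors-bound 0≤s N (move true d x) (move-≥ true d l<x , move-≤ true d x<l)
      collect : ∀ q p l m k → q ℤ.* (p ℤ.* l ℤ.* m ℤ.+ p ℤ.* l ℤ.* k) ≡ q ℤ.* p ℤ.* l ℤ.* (m ℤ.+ k)
      collect = ℤ-Solver.solve-∀
      factor : ∀ q r a b → q ℤ.* (r ℤ.* a ℤ.+ r ℤ.* b) ≡ q ℤ.* (r ℤ.* (a ℤ.+ b))
      factor = ℤ-Solver.solve-∀
      -- The neighbouring heights sum to `2 (h - 1)` with `h = height x`, and (q - 1) h - q (h - 1)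
      -- = q - h.
      gain : ∀ q r x → r ℤ.* (ℤ.+ 2 ℤ.* (q ℤ.- (q ℤ.- x ℤ.* x))) ≡
        (ℤ.+ 2 ℤ.* (q ℤ.- ℤ.1ℤ) ℤ.* r) ℤ.* (q ℤ.- x ℤ.* x) ℤ.-
        q ℤ.* (r ℤ.* ((q ℤ.- (ℤ.1ℤ ℤ.+ x) ℤ.* (ℤ.1ℤ ℤ.+ x)) ℤ.+ (q ℤ.- (ℤ.-1ℤ ℤ.+ x) ℤ.* (ℤ.-1ℤ ℤ.+ x))))
      gain = ℤ-Solver.solve-∀

  -- The factor 2 is `Q / L²`, the height at the centre over its least value on the interval.
  few-confined : ∀ q → suc q ≡ 2 * (L * L) → 0 < L → ∀ N →
    suc q ^ N * wordSum (indicator ∘ confined ℤ.0ℤ) N ≤ 2 * (2 * q) ^ N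
  few-confined q 1+q≡ 0<L N = ℤₚ.drop‿+≤+ (subst₂ ℤ._≤_ lhs rhs cancelled)
    where
    m = survivors ℤ.0ℤ N
    Q≡ : Q ≡ ℤ.+ suc q
    Q≡ = sym (trans (cong ℤ.+_ 1+q≡) (trans (ℤₚ.pos-* 2 (L * L)) (cong (ℤ.+ 2 ℤ.*_) (ℤₚ.pos-* L L))))
    shrink≡ : shrink ≡ ℤ.+ (2 * q)
    shrink≡ = trans (cong (λ z → ℤ.+ 2 ℤ.* (z ℤ.- ℤ.1ℤ)) Q≡) (sym (ℤₚ.pos-* 2 q))
    pow-pos : ∀ b N → pow (ℤ.+ b) N ≡ ℤ.+ (b ^ N)
    pow-pos b zero    = refl
    pow-pos b (suc N) = trans (cong (ℤ.+ b ℤ.*_) (pow-pos b N)) (sym (ℤₚ.pos-* b (b ^ N)))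
    instance
      L²-pos : ℤ.Positive L²
      L²-pos = ℤ.positive (subst (ℤ.0ℤ ℤ.<_) (ℤₚ.pos-* L L) (ℤ.+<+ (*-mono-≤ 0<L 0<L)))
    swap : ∀ p l m → p ℤ.* l ℤ.* m ≡ p ℤ.* m ℤ.* l
    swap = ℤ-Solver.solve-∀
    centre : ∀ r l → r ℤ.* (ℤ.+ 2 ℤ.* l ℤ.- ℤ.0ℤ) ≡ ℤ.+ 2 ℤ.* r ℤ.* l
    centre = ℤ-Solver.solve-∀
    cancelled : pow Q N ℤ.* ℤ.+ m ℤ.≤ ℤ.+ 2 ℤ.* pow shrink N
    cancelled = ℤₚ.*-cancelʳ-≤-pos _ _ L² (subst₂ ℤ._≤_
      (swap (pow Q N) L² (ℤ.+ m)) (centre (pow shrink N) L²)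
      (survivors-bound (subst (ℤ.0ℤ ℤ.≤_) (sym shrink≡) (ℤ.+≤+ z≤n)) N ℤ.0ℤ
        (ℤₚ.neg-mono-≤ (ℤ.+≤+ z≤n) , ℤ.+≤+ z≤n)))
    lhs : pow Q N ℤ.* ℤ.+ m ≡ ℤ.+ (suc q ^ N * m)
    lhs = trans (cong (λ b → pow b N ℤ.* ℤ.+ m) Q≡)
      (trans (cong (ℤ._* ℤ.+ m) (pow-pos (suc q) N)) (sym (ℤₚ.pos-* (suc q ^ N) m)))
    rhs : ℤ.+ 2 ℤ.* pow shrink N ≡ ℤ.+ (2 * (2 * q) ^ N)
    rhs = trans (cong (λ b → ℤ.+ 2 ℤ.* pow b N) shrink≡)
      (trans (cong (ℤ.+ 2 ℤ.*_) (pow-pos (2 * q) N)) (sym (ℤₚ.pos-* 2 ((2 * q) ^ N))))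

  -- The same word drives the lift `a + x` and its mirror image `b - x`; an exit at the bottom for
  -- one is a climb for the other.
  unconfined⇒reaches : ∀ {t a b} → t ℤ.≤ a ℤ.+ ℤ.+ L → t ℤ.≤ b ℤ.+ ℤ.+ L →
    ∀ ds x u v → u ≡ a ℤ.+ x → v ≡ b ℤ.- x → confined x ds ≡ false →
    Reaches true t u ds ⊎ Reaches false t v ds
  unconfined⇒reaches {t} {a} {b} t≤a+L t≤b+L = go
    where
    outside : ∀ x {ds u v} → u ≡ a ℤ.+ x → v ≡ b ℤ.- x → ¬ Inside x →
              Reaches true t u ds ⊎ Reaches false t v ds
    outside x refl refl ¬in with x ℤₚ.<? ℤ.+ L
    ... | no  x≮L = inj₁ (now (ℤₚ.≤-trans t≤a+L (ℤₚ.+-monoʳ-≤ a (ℤₚ.≮⇒≥ x≮L))))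
    ... | yes x<L = inj₂ (now (ℤₚ.≤-trans t≤b+L (ℤₚ.+-monoʳ-≤ b L≤-x)))
      where
      L≤-x : ℤ.+ L ℤ.≤ ℤ.- x
      L≤-x = subst (ℤ._≤ ℤ.- x) (ℤₚ.neg-involutive (ℤ.+ L))
        (ℤₚ.neg-mono-≤ (ℤₚ.≮⇒≥ (λ -L<x → ¬in (-L<x , x<L))))
    shift : ∀ d x → move true d (a ℤ.+ x) ≡ a ℤ.+ move true d x
    shift true  x = eq a x
      where
      eq : ∀ a x → ℤ.1ℤ ℤ.+ (a ℤ.+ x) ≡ a ℤ.+ (ℤ.1ℤ ℤ.+ x)
      eq = ℤ-Solver.solve-∀
    shift false x = eq a x
      where
      eq : ∀ a x → ℤ.-1ℤ ℤ.+ (a ℤ.+ x) ≡ a ℤ.+ (ℤ.-1ℤ ℤ.+ x)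
      eq = ℤ-Solver.solve-∀
    reflect : ∀ d x → move false d (b ℤ.- x) ≡ b ℤ.- move true d x
    reflect true  x = eq b x
      where
      eq : ∀ b x → ℤ.-1ℤ ℤ.+ (b ℤ.- x) ≡ b ℤ.- (ℤ.1ℤ ℤ.+ x)
      eq = ℤ-Solver.solve-∀
    reflect false x = eq b x
      where
      eq : ∀ b x → ℤ.1ℤ ℤ.+ (b ℤ.- x) ≡ b ℤ.- (ℤ.-1ℤ ℤ.+ x)
      eq = ℤ-Solver.solve-∀
    go : ∀ ds x u v → u ≡ a ℤ.+ x → v ≡ b ℤ.- x → confined x ds ≡ false →
         Reaches true t u ds ⊎ Reaches false t v ds
    go []       x u v eu ev c with inside? x
    ... | no ¬in = outside x eu ev ¬in
    go (d ∷ ds) x u v eu ev c with inside? x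
    ... | no ¬in = outside x eu ev ¬in
    ... | yes _ with go ds (move true d x) (move true d u) (move false d v)
                      (trans (cong (move true d) eu) (shift d x))
                      (trans (cong (move false d) ev) (reflect d x)) c
    ...   | inj₁ r = inj₁ (later r)
    ...   | inj₂ r = inj₂ (later r)

-- Combining the two estimates

indicator-mono : ∀ a b → (T a → T b) → indicator a ≤ indicator b
indicator-mono false b     f = z≤n
indicator-mono true  true  f = ≤-refl
indicator-mono true  false f = ⊥-elim (f tt)

module _ (n : ℕ) .{{_ : NonZero n}} where

  track⇒accepts-signature : ∀ σ {u v ds es} → InPhase n below 0 u →
    level n 2 ℤ.< v → v ℤ.< level n 6 → Track n σ u ds v es →
    T (accepts n σ (expecting n 0 (signature n σ below 0 u ds)) v es)
  track⇒accepts-signature σ {u} {v} {ds} {es} ip l< v< tr with signature n σ below 0 u ds in eq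
  ... | []     = accepts-settled n σ 0 v es
  ... | b ∷ bs = track⇒accepts n σ tr ip (InWatch-expecting n (b ∷ bs) l< v<)
                   (Coupled-expecting n σ 0 b bs) (sym eq)

  level-* : ∀ j → level n j ≡ ℤ.+ (j * n)
  level-* zero    = refl
  level-* (suc j) = trans (cong (λ l → ℤ.+ n ℤ.+ l) (level-* j)) (sym (ℤₚ.pos-+ n (j * n)))

  length-allFin : length (allFin n) ≡ n
  length-allFin = length-tabulate {n = n} id

  partners : ℕ → Fin n → List Bool → Fin n → ℕ
  partners N v ds w = wordSum (indicator ∘ schedulable n v ds w) N

  module _ {c K : ℕ} (c·3^r≤4^r : ∀ r → K ≤ r → c * 3 ^ r ≤ 4 ^ r) where

    private
      accepted-fraction : ∀ σ bs N → K ≤ length bs →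
        c * accepted n σ (expecting n 0 bs) (level n 4) N ≤ 2 ^ N
      accepted-fraction σ bs N K≤ = *-cancelʳ-≤ _ _ (3 ^ r) {{m^n≢0 3 r}} (begin
        c * m * 3 ^ r      ≡⟨ swap c m (3 ^ r) ⟩
        c * 3 ^ r * m      ≤⟨ *-monoˡ-≤ m (c·3^r≤4^r r K≤) ⟩
        4 ^ r * m          ≤⟨ few-accepted n σ bs N ⟩
        2 ^ N * 3 ^ r      ∎)
        where
        open ≤-Reasoning
        r = length bs
        m = accepted n σ (expecting n 0 bs) (level n 4) N
        swap : ∀ c m p → c * m * p ≡ c * p * m
        swap = solve-∀

      reaching-partners : ∀ σ N v ds w {d u} → _leads_by_ n v w d → d < n →
        Ahead σ d u (level n 4) → Reaches σ (level n (stageEnd n K 0)) u ds →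
        c * partners N v ds w ≤ 2 ^ N
      reaching-partners σ N v ds w {d} {u} v-leads d<n ahead r = ≤-trans
        (*-monoʳ-≤ c (wordSum-mono (λ es → indicator-mono _ _ (accept es)) N))
        (accepted-fraction σ (signature n σ below 0 u ds) N (reaches⇒long-signature n σ K ip r))
        where
        ip : InPhase n below 0 u
        ip = near-below n 4 (Near-sym n (Ahead⇒Near n σ d u (level n 4) d<n ahead)) ℤₚ.≤-refl
        accept : ∀ es → T (schedulable n v ds w es) →
          T (accepts n σ (expecting n 0 (signature n σ below 0 u ds)) (level n 4) es)
        accept es t = track⇒accepts-signature σ ip (level-< n 1 2) (level-< n 1 4)
          (schedule⇒track n σ u (level n 4) (schedule n v ds w es d v-leads d<n t) d<n ahead)

    -- A confined first walk is charged all its partners; the rarity of such walks is used only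
    -- after summing over `ds`.
    partners-bound : ∀ N v ds w →
      c * partners N v ds w ≤ c * 2 ^ N * indicator (confined (K * 6 * n) ℤ.0ℤ ds) + 2 ^ N
    partners-bound N v ds w with confined (K * 6 * n) ℤ.0ℤ ds in conf
    ... | true  = ≤-trans (*-monoʳ-≤ c (wordSum-indicator≤ (schedulable n v ds w) N))
                    (≤-trans (≤-reflexive (sym (*-identityʳ (c * 2 ^ N)))) (m≤m+n _ (2 ^ N)))
    ... | false with lead n v w
    ...   | d , v-leads , d<n with unconfined⇒reaches (K * 6 * n)
              {t = level n (stageEnd n K 0)}
              {a = ℤ.+ d ℤ.+ level n 4} {b = level n 4 ℤ.- ℤ.+ d} up down
              ds ℤ.0ℤ _ _ refl refl conf
      where
      -- Both lifts put the second token at level 4 and the first at distance `d < n` from it, hence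
      -- at level 3 or above; a climb of 6 K n from there completes `K` stages.
      top : level n (stageEnd n K 0) ≡ level n 3 ℤ.+ ℤ.+ (K * 6 * n)
      top = trans (cong (level n) (trans (stageEnd-* n K 0) (cong (3 +_) (+-identityʳ (K * 6)))))
        (trans (eq (ℤ.+ n) (level n (K * 6))) (cong (λ l → level n 3 ℤ.+ l) (level-* (K * 6))))
        where
        eq : ∀ ν l → ν ℤ.+ (ν ℤ.+ (ν ℤ.+ l)) ≡ (ν ℤ.+ (ν ℤ.+ (ν ℤ.+ ℤ.0ℤ))) ℤ.+ l
        eq = ℤ-Solver.solve-∀
      up : level n (stageEnd n K 0) ℤ.≤ ℤ.+ d ℤ.+ level n 4 ℤ.+ ℤ.+ (K * 6 * n)
      up = subst (ℤ._≤ ℤ.+ d ℤ.+ level n 4 ℤ.+ ℤ.+ (K * 6 * n)) (sym top) (ℤₚ.+-monoˡ-≤ (ℤ.+ (K * 6 * n))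
        (ℤₚ.≤-trans (level-mono n {3} {4} (n≤1+n 3)) (ℤₚ.i≤j+i (level n 4) (ℤ.+ d))))
      down : level n (stageEnd n K 0) ℤ.≤ level n 4 ℤ.- ℤ.+ d ℤ.+ ℤ.+ (K * 6 * n)
      down = subst (ℤ._≤ level n 4 ℤ.- ℤ.+ d ℤ.+ ℤ.+ (K * 6 * n)) (sym top) (ℤₚ.+-monoˡ-≤ (ℤ.+ (K * 6 * n))
        (ℤₚ.0≤i-j⇒j≤i {level n 4 ℤ.- ℤ.+ d} {level n 3}
          (subst (ℤ.0ℤ ℤ.≤_) (eq (ℤ.+ n) (ℤ.+ d)) (ℤₚ.i≤j⇒0≤j-i (ℤ.+≤+ (<⇒≤ d<n))))))
        where
        eq : ∀ ν d → ν ℤ.- d ≡ (ν ℤ.+ (ν ℤ.+ (ν ℤ.+ (ν ℤ.+ ℤ.0ℤ))) ℤ.- d) ℤ.- (ν ℤ.+ (ν ℤ.+ (ν ℤ.+ ℤ.0ℤ)))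
        eq = ℤ-Solver.solve-∀
    ...     | inj₁ r = ≤-trans (reaching-partners true N v ds w v-leads d<n (ℤₚ.+-identityʳ _) r)
                         (m≤n+m (2 ^ N) _)
    ...     | inj₂ r = ≤-trans (reaching-partners false N v ds w v-leads d<n (eq (level n 4) (ℤ.+ d)) r)
                         (m≤n+m (2 ^ N) _)
      where
      eq : ∀ l d → l ≡ d ℤ.+ (l ℤ.- d ℤ.- ℤ.0ℤ)
      eq = ℤ-Solver.solve-∀

    goodPartners-bound : ∀ N v ds → c * goodPartners n N v ds ≤
      (n * (c * 2 ^ N)) * indicator (confined (K * 6 * n) ℤ.0ℤ ds) + n * 2 ^ N
    goodPartners-bound N v ds = begin
      c * goodPartners n N v ds                            ≡⟨ sym (sumOver-scale c (partners N v ds) (allFin n)) ⟩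
      sumOver (λ w → c * partners N v ds w) (allFin n)     ≤⟨ sumOver-mono (partners-bound N v ds) (allFin n) ⟩
      sumOver (λ _ → c * 2 ^ N * i + 2 ^ N) (allFin n)     ≡⟨ sumOver-const _ (allFin n) ⟩
      length (allFin n) * (c * 2 ^ N * i + 2 ^ N)          ≡⟨ cong (_* (c * 2 ^ N * i + 2 ^ N)) length-allFin ⟩
      n * (c * 2 ^ N * i + 2 ^ N)                          ≡⟨ distribute n (c * 2 ^ N) i (2 ^ N) ⟩
      (n * (c * 2 ^ N)) * i + n * 2 ^ N                    ∎
      where
      open ≤-Reasoning
      i = indicator (confined (K * 6 * n) ℤ.0ℤ ds)
      distribute : ∀ n a i b → n * (a * i + b) ≡ n * a * i + n * b
      distribute = solve-∀

    -- 3 = 2 + 1: confined first walks contribute 2, walks whose stages all had to be survived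
    -- contribute 1.
    goodCount-bound : ∀ N →
      c * wordSum (indicator ∘ confined (K * 6 * n) ℤ.0ℤ) N ≤ 2 * 2 ^ N →
      c * goodCount n N ≤ 3 * totalCount n N
    goodCount-bound N few = begin
      c * goodCount n N
        ≡⟨ cong (c *_) (goodCount-sum n N) ⟩
      c * sumOver (λ v → wordSum (goodPartners n N v) N) (allFin n)
        ≡⟨ sym (sumOver-scale c _ (allFin n)) ⟩
      sumOver (λ v → c * wordSum (goodPartners n N v) N) (allFin n)
        ≤⟨ sumOver-mono per-start (allFin n) ⟩
      sumOver (λ _ → n * (3 * (2 ^ N * 2 ^ N))) (allFin n)
        ≡⟨ sumOver-const _ (allFin n) ⟩
      length (allFin n) * (n * (3 * (2 ^ N * 2 ^ N)))
        ≡⟨ cong (_* (n * (3 * (2 ^ N * 2 ^ N)))) length-allFin ⟩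
      n * (n * (3 * (2 ^ N * 2 ^ N)))
        ≡⟨ total n (2 ^ N) ⟩
      3 * totalCount n N ∎
      where
      open ≤-Reasoning
      total : ∀ n p → n * (n * (3 * (p * p))) ≡ 3 * ((n * p) * (n * p))
      total = solve-∀
      S = wordSum (indicator ∘ confined (K * 6 * n) ℤ.0ℤ) N
      regroup : ∀ n c p s → (n * (c * p)) * s + p * (n * p) ≡ (n * p) * (c * s) + n * (p * p)
      regroup = solve-∀
      collect : ∀ n p → (n * p) * (2 * p) + n * (p * p) ≡ n * (3 * (p * p))
      collect = solve-∀
      per-start : ∀ v → c * wordSum (goodPartners n N v) N ≤ n * (3 * (2 ^ N * 2 ^ N))
      per-start v = begin
        c * wordSum (goodPartners n N v) N
          ≡⟨ trans (sym (+-identityʳ _)) (cong (c * wordSum (goodPartners n N v) N +_) (sym (*-zeroʳ (2 ^ N)))) ⟩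
        c * wordSum (goodPartners n N v) N + 2 ^ N * 0
          ≡⟨ sym (wordSum-affine c 0 (goodPartners n N v) N) ⟩
        wordSum (λ ds → c * goodPartners n N v ds + 0) N
          ≤⟨ wordSum-mono (λ ds → ≤-trans (≤-reflexive (+-identityʳ _)) (goodPartners-bound N v ds)) N ⟩
        wordSum (λ ds → (n * (c * 2 ^ N)) * indicator (confined (K * 6 * n) ℤ.0ℤ ds) + n * 2 ^ N) N
          ≡⟨ wordSum-affine (n * (c * 2 ^ N)) (n * 2 ^ N) _ N ⟩
        (n * (c * 2 ^ N)) * S + 2 ^ N * (n * 2 ^ N)
          ≡⟨ regroup n c (2 ^ N) S ⟩
        (n * 2 ^ N) * (c * S) + n * (2 ^ N * 2 ^ N)
          ≤⟨ +-monoˡ-≤ _ (*-monoʳ-≤ (n * 2 ^ N) few) ⟩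
        (n * 2 ^ N) * (2 * 2 ^ N) + n * (2 ^ N * 2 ^ N)
          ≡⟨ collect n (2 ^ N) ⟩
        n * (3 * (2 ^ N * 2 ^ N)) ∎

  -- The subtracted pairs are those starting on a common vertex, which collide at once.
  goodCount-gap : ∀ N → goodCount n N + n * (2 ^ N * 2 ^ N) ≤ totalCount n N
  goodCount-gap N = subst₂ _≤_ lhs rhs (sum-gap (allFin n))
    where
    p = 2 ^ N
    partners-self : ∀ v ds → partners N v ds v ≡ 0
    partners-self v ds = n≤0⇒n≡0 (≤-trans
      (wordSum-mono {h = λ _ → 0} (λ es → indicator-mono (schedulable n v ds v es) false
        (λ t → schedulable⇒≢ n v ds v es t refl)) N)
      (≤-reflexive (trans (wordSum-const 0 N) (*-zeroʳ p))))
    per-word : ∀ v ds → 1 * goodPartners n N v ds + p ≤ n * p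
    per-word v ds = subst₂ _≤_ (cong (_+ p) (sym (*-identityˡ (goodPartners n N v ds))))
      (cong (_* p) length-allFin)
      (sumOver-missing {g = partners N v ds} (λ w → wordSum-indicator≤ (schedulable n v ds w) N)
        (partners-self v ds) (∈-allFin v))
    per-start : ∀ v → wordSum (goodPartners n N v) N + p * p ≤ p * (n * p)
    per-start v = subst₂ _≤_
      (trans (wordSum-affine 1 p (goodPartners n N v) N) (cong (_+ p * p) (*-identityˡ _)))
      (wordSum-const (n * p) N) (wordSum-mono (per-word v) N)
    sum-gap : ∀ vs → sumOver (λ v → wordSum (goodPartners n N v) N) vs + length vs * (p * p) ≤
                     length vs * (p * (n * p))
    sum-gap []       = z≤n
    sum-gap (v ∷ vs) = subst (_≤ p * (n * p) + length vs * (p * (n * p)))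
      (interchange (wordSum (goodPartners n N v) N) (p * p) _ _)
      (+-mono-≤ (per-start v) (sum-gap vs))
      where
      interchange : ∀ a b c d → (a + b) + (c + d) ≡ (a + c) + (b + d)
      interchange = solve-∀
    lhs : sumOver (λ v → wordSum (goodPartners n N v) N) (allFin n) + length (allFin n) * (p * p) ≡
          goodCount n N + n * (p * p)
    lhs = cong₂ _+_ (sym (goodCount-sum n N)) (cong (_* (p * p)) length-allFin)
    rhs : length (allFin n) * (p * (n * p)) ≡ totalCount n N
    rhs = trans (cong (_* (p * (n * p))) length-allFin) (eq n p)
      where
      eq : ∀ n p → n * (p * (n * p)) ≡ (n * p) * (n * p)
      eq = solve-∀

-- From a loss per step to halvings

^-distribˡ-* : ∀ k a b → (a * b) ^ k ≡ a ^ k * b ^ k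
^-distribˡ-* zero    a b = refl
^-distribˡ-* (suc k) a b = trans (cong (a * b *_) (^-distribˡ-* k a b)) (eq a b (a ^ k) (b ^ k))
  where
  eq : ∀ a b p q → a * b * (p * q) ≡ a * p * (b * q)
  eq = solve-∀

-- Bernoulli's inequality 1 + k/q ≤ (1 + 1/q)^k, multiplied by q^(k+1).
bernoulli : ∀ q k → q ^ k * (q + k) ≤ q * suc q ^ k
bernoulli q zero    = ≤-reflexive (eq q)
  where
  eq : ∀ q → 1 * (q + 0) ≡ q * 1
  eq = solve-∀
bernoulli q (suc k) = begin
  q * q ^ k * (q + suc k)            ≤⟨ m≤m+n _ (q ^ k * k) ⟩
  q * q ^ k * (q + suc k) + q ^ k * k ≡⟨ eq q k (q ^ k) ⟩
  suc q * (q ^ k * (q + k))          ≤⟨ *-monoʳ-≤ (suc q) (bernoulli q k) ⟩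
  suc q * (q * suc q ^ k)            ≡⟨ swap (suc q) q (suc q ^ k) ⟩
  q * suc q ^ suc k                  ∎
  where
  open ≤-Reasoning
  eq : ∀ q k p → q * p * (q + (1 + k)) + p * k ≡ (1 + q) * (p * (q + k))
  eq = solve-∀
  swap : ∀ a b c → a * (b * c) ≡ b * (a * c)
  swap = solve-∀

2·q^[1+q]≤[1+q]^[1+q] : ∀ q .{{_ : NonZero q}} → 2 * q ^ suc q ≤ suc q ^ suc q
2·q^[1+q]≤[1+q]^[1+q] q = *-cancelˡ-≤ q (≤-trans
  (≤-trans (m≤m+n _ (q ^ suc q)) (≤-reflexive (eq q (q ^ suc q))))
  (bernoulli q (suc q)))
  where
  eq : ∀ q p → q * (2 * p) + p ≡ p * (q + (1 + q))
  eq = solve-∀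

-- With `Q = suc q`, each of `t` blocks of `Q` steps loses a factor (1 - 1/Q)^Q ≤ 1/2; the loss in
-- the remaining steps is dropped.
halvings : ∀ q .{{_ : NonZero q}} t N → suc q * t ≤ N → 2 ^ t * q ^ N ≤ suc q ^ N
halvings q t N Qt≤N = begin
  2 ^ t * q ^ N                       ≡⟨ cong (λ N → 2 ^ t * q ^ N) N≡ ⟩
  2 ^ t * q ^ (Q * t + r)             ≡⟨ cong (2 ^ t *_) (^-distribˡ-+-* q (Q * t) r) ⟩
  2 ^ t * (q ^ (Q * t) * q ^ r)       ≡⟨ cong (λ x → 2 ^ t * (x * q ^ r)) (sym (^-*-assoc q Q t)) ⟩
  2 ^ t * ((q ^ Q) ^ t * q ^ r)       ≡⟨ sym (*-assoc (2 ^ t) _ _) ⟩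
  2 ^ t * (q ^ Q) ^ t * q ^ r         ≡⟨ cong (_* q ^ r) (sym (^-distribˡ-* t 2 (q ^ Q))) ⟩
  (2 * q ^ Q) ^ t * q ^ r             ≤⟨ *-mono-≤ (^-monoˡ-≤ t (2·q^[1+q]≤[1+q]^[1+q] q)) (^-monoˡ-≤ r (n≤1+n q)) ⟩
  (Q ^ Q) ^ t * Q ^ r                 ≡⟨ cong (_* Q ^ r) (^-*-assoc Q Q t) ⟩
  Q ^ (Q * t) * Q ^ r                 ≡⟨ sym (^-distribˡ-+-* Q (Q * t) r) ⟩
  Q ^ (Q * t + r)                     ≡⟨ cong (Q ^_) (sym N≡) ⟩
  Q ^ N                               ∎
  where
  open ≤-Reasoning
  Q = suc q
  r = N ∸ Q * t
  N≡ : N ≡ Q * t + r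
  N≡ = sym (m+[n∸m]≡n Qt≤N)

-- The exponential series

fromℕ : ℕ → ℚ
fromℕ m = ℤ.+ m ℚ./ 1

private
  toℚᵘ-fromℕ : ∀ m → ℚ.toℚᵘ (fromℕ m) ℚᵘ.≃ ℚᵘ.mkℚᵘ (ℤ.+ m) 0
  toℚᵘ-fromℕ m = ℚₚ.toℚᵘ-fromℚᵘ (ℚᵘ.mkℚᵘ (ℤ.+ m) 0)

fromℕ-* : ∀ m k → fromℕ (m * k) ≡ fromℕ m ℚ.* fromℕ k
fromℕ-* m k = ℚₚ.toℚᵘ-injective (begin
  ℚ.toℚᵘ (fromℕ (m * k))                              ≈⟨ toℚᵘ-fromℕ (m * k) ⟩
  ℚᵘ.mkℚᵘ (ℤ.+ (m * k)) 0                             ≈⟨ ℚᵘ.*≡* (cong (ℤ._* ℤ.1ℤ) (ℤₚ.pos-* m k)) ⟩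
  ℚᵘ.mkℚᵘ (ℤ.+ m) 0 ℚᵘ.* ℚᵘ.mkℚᵘ (ℤ.+ k) 0            ≈⟨ ℚᵘₚ.*-cong (ℚᵘₚ.≃-sym (toℚᵘ-fromℕ m)) (ℚᵘₚ.≃-sym (toℚᵘ-fromℕ k)) ⟩
  ℚ.toℚᵘ (fromℕ m) ℚᵘ.* ℚ.toℚᵘ (fromℕ k)              ≈⟨ ℚᵘₚ.≃-sym (ℚₚ.toℚᵘ-homo-* (fromℕ m) (fromℕ k)) ⟩
  ℚ.toℚᵘ (fromℕ m ℚ.* fromℕ k)                        ∎)
  where open ℚᵘₚ.≃-Reasoning

fromℕ-+ : ∀ m k → fromℕ (m + k) ≡ fromℕ m ℚ.+ fromℕ k
fromℕ-+ m k = ℚₚ.toℚᵘ-injective (begin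
  ℚ.toℚᵘ (fromℕ (m + k))                              ≈⟨ toℚᵘ-fromℕ (m + k) ⟩
  ℚᵘ.mkℚᵘ (ℤ.+ (m + k)) 0                             ≈⟨ ℚᵘ.*≡* (cong (ℤ._* ℤ.1ℤ) (trans (ℤₚ.pos-+ m k)
    (cong₂ ℤ._+_ (sym (ℤₚ.*-identityʳ (ℤ.+ m))) (sym (ℤₚ.*-identityʳ (ℤ.+ k)))))) ⟩
  ℚᵘ.mkℚᵘ (ℤ.+ m) 0 ℚᵘ.+ ℚᵘ.mkℚᵘ (ℤ.+ k) 0            ≈⟨ ℚᵘₚ.+-cong (ℚᵘₚ.≃-sym (toℚᵘ-fromℕ m)) (ℚᵘₚ.≃-sym (toℚᵘ-fromℕ k)) ⟩
  ℚ.toℚᵘ (fromℕ m) ℚᵘ.+ ℚ.toℚᵘ (fromℕ k)              ≈⟨ ℚᵘₚ.≃-sym (ℚₚ.toℚᵘ-homo-+ (fromℕ m) (fromℕ k)) ⟩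
  ℚ.toℚᵘ (fromℕ m ℚ.+ fromℕ k)                        ∎)
  where open ℚᵘₚ.≃-Reasoning

fromℕ-mono-≤ : ∀ {m k} → m ≤ k → fromℕ m ℚ.≤ fromℕ k
fromℕ-mono-≤ {m} {k} m≤k = ℚₚ.toℚᵘ-cancel-≤
  (ℚᵘₚ.≤-respˡ-≃ (ℚᵘₚ.≃-sym (toℚᵘ-fromℕ m)) (ℚᵘₚ.≤-respʳ-≃ (ℚᵘₚ.≃-sym (toℚᵘ-fromℕ k))
    (ℚᵘ.*≤* (ℤₚ.*-monoʳ-≤-nonNeg ℤ.1ℤ (ℤ.+≤+ m≤k)))))

fromℕ-mono-< : ∀ {m k} → m < k → fromℕ m ℚ.< fromℕ k
fromℕ-mono-< {m} {k} m<k = ℚₚ.toℚᵘ-cancel-<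
  (ℚᵘₚ.<-respˡ-≃ (ℚᵘₚ.≃-sym (toℚᵘ-fromℕ m)) (ℚᵘₚ.<-respʳ-≃ (ℚᵘₚ.≃-sym (toℚᵘ-fromℕ k))
    (ℚᵘ.*<* (ℤₚ.*-monoʳ-<-pos ℤ.1ℤ (ℤ.+<+ m<k)))))

fromℕ-nonNeg : ∀ m → ℚ.NonNegative (fromℕ m)
fromℕ-nonNeg m = ℚₚ.normalize-nonNeg m 1

fromℕ-pos : ∀ m .{{_ : NonZero m}} → ℚ.Positive (fromℕ m)
fromℕ-pos m = ℚₚ.normalize-pos m 1

recip : ∀ m .{{_ : NonZero m}} → ℚ
recip m = ℤ.1ℤ ℚ./ m

recip-pos : ∀ m .{{_ : NonZero m}} → ℚ.Positive (recip m)
recip-pos m = ℚₚ.normalize-pos 1 m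

recip-inverse : ∀ m .{{_ : NonZero m}} → recip m ℚ.* fromℕ m ≡ 1ℚ
recip-inverse (suc m) = ℚₚ.toℚᵘ-injective (begin
  ℚ.toℚᵘ (recip (suc m) ℚ.* fromℕ (suc m))             ≈⟨ ℚₚ.toℚᵘ-homo-* (recip (suc m)) (fromℕ (suc m)) ⟩
  ℚ.toℚᵘ (recip (suc m)) ℚᵘ.* ℚ.toℚᵘ (fromℕ (suc m))   ≈⟨ ℚᵘₚ.*-cong (ℚₚ.toℚᵘ-fromℚᵘ (ℚᵘ.mkℚᵘ ℤ.1ℤ m)) (toℚᵘ-fromℕ (suc m)) ⟩
  ℚᵘ.mkℚᵘ ℤ.1ℤ m ℚᵘ.* ℚᵘ.mkℚᵘ (ℤ.+ suc m) 0            ≈⟨ ℚᵘ.*≡* (cong ℤ.+_ (eq (suc m))) ⟩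
  ℚ.toℚᵘ 1ℚ                                            ∎)
  where
  open ℚᵘₚ.≃-Reasoning
  eq : ∀ k → 1 * k * 1 ≡ 1 * (k * 1)
  eq = solve-∀

recip-nonNeg : ∀ m .{{_ : NonZero m}} → ℚ.NonNegative (recip m)
recip-nonNeg m = ℚₚ.normalize-nonNeg 1 m

recip≤1 : ∀ m .{{_ : NonZero m}} → recip m ℚ.≤ 1ℚ
recip≤1 m = subst₂ ℚ._≤_ (ℚₚ.*-identityʳ (recip m)) (recip-inverse m)
  (ℚₚ.*-monoˡ-≤-nonNeg (recip m) {{recip-nonNeg m}}
    (fromℕ-mono-≤ {1} {m} (>-nonZero⁻¹ m)))

expTerm-nonNeg : ∀ s .{{_ : ℚ.NonNegative s}} k → ℚ.NonNegative (expTerm s k)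
expTerm-nonNeg s zero    = _
expTerm-nonNeg s (suc k) = ℚₚ.nonNeg*nonNeg⇒nonNeg (expTerm s k) {{expTerm-nonNeg s k}} (s ℚ.* recip (suc k))
  {{ℚₚ.nonNeg*nonNeg⇒nonNeg s (recip (suc k)) {{recip-nonNeg (suc k)}}}}

expPartial-mono : ∀ s .{{_ : ℚ.NonNegative s}} i k → expPartial s k ℚ.≤ expPartial s (i + k)
expPartial-mono s zero    k = ℚₚ.≤-refl
expPartial-mono s (suc i) k = ℚₚ.≤-trans (expPartial-mono s i k)
  (subst (ℚ._≤ expPartial s (suc i + k)) (ℚₚ.+-identityʳ (expPartial s (i + k)))
    (ℚₚ.+-monoʳ-≤ (expPartial s (i + k))
      (ℚₚ.nonNegative⁻¹ (expTerm s (i + k)) {{expTerm-nonNeg s (i + k)}})))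

-- Once the terms at least halve, partial sum + 2 · (next term) no longer increases.
expPartial-bound : ∀ s .{{_ : ℚ.NonNegative s}} k₀ → fromℕ 2 ℚ.* s ℚ.≤ fromℕ (suc k₀) →
  ∀ k → expPartial s k ℚ.≤ expPartial s k₀ ℚ.+ fromℕ 2 ℚ.* expTerm s k₀
expPartial-bound s k₀ 2s≤ k = ℚₚ.≤-trans (expPartial-mono s k₀ k)
  (subst (λ j → expPartial s j ℚ.≤ expPartial s k₀ ℚ.+ fromℕ 2 ℚ.* expTerm s k₀) (+-comm k k₀)
    (ℚₚ.≤-trans (drop (k + k₀)) (decreasing k)))
  where
  majorant : ℕ → ℚ
  majorant j = expPartial s j ℚ.+ fromℕ 2 ℚ.* expTerm s j
  drop : ∀ j → expPartial s j ℚ.≤ majorant j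
  drop j = subst (ℚ._≤ majorant j) (ℚₚ.+-identityʳ (expPartial s j))
    (ℚₚ.+-monoʳ-≤ (expPartial s j) (ℚₚ.nonNegative⁻¹ _
      {{ℚₚ.nonNeg*nonNeg⇒nonNeg (fromℕ 2) (expTerm s j) {{expTerm-nonNeg s j}}}}))
  halves : ∀ j → k₀ ≤ j → fromℕ 2 ℚ.* (s ℚ.* recip (suc j)) ℚ.≤ 1ℚ
  halves j k₀≤j = subst₂ ℚ._≤_ (ℚₚ.*-assoc (fromℕ 2) s (recip (suc j)))
    (trans (ℚₚ.*-comm (fromℕ (suc j)) (recip (suc j))) (recip-inverse (suc j)))
    (ℚₚ.*-monoʳ-≤-nonNeg (recip (suc j)) {{recip-nonNeg (suc j)}}
      (ℚₚ.≤-trans 2s≤ (fromℕ-mono-≤ {suc k₀} {suc j} (s≤s k₀≤j))))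
  step : ∀ j → k₀ ≤ j → majorant (suc j) ℚ.≤ majorant j
  step j k₀≤j = subst₂ ℚ._≤_
    (solve 4 (λ p t a c → p :+ t :+ t :* (c :* a) := (p :+ t) :+ c :* (t :* a)) refl
      (expPartial s j) (expTerm s j) (s ℚ.* recip (suc j)) (fromℕ 2))
    (solve 2 (λ p t → p :+ t :+ t :* con 1ℚ := p :+ con (fromℕ 2) :* t) refl
      (expPartial s j) (expTerm s j))
    (ℚₚ.+-monoʳ-≤ (expPartial s j ℚ.+ expTerm s j)
      (ℚₚ.*-monoˡ-≤-nonNeg (expTerm s j) {{expTerm-nonNeg s j}} (halves j k₀≤j)))
    where open +-*-Solver
  decreasing : ∀ i → majorant (i + k₀) ℚ.≤ majorant k₀
  decreasing zero    = ℚₚ.≤-refl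
  decreasing (suc i) = ℚₚ.≤-trans (step (i + k₀) (m≤n+m k₀ i)) (decreasing i)

m^j*m!≤[m+j]! : ∀ m j → m ^ j * m ! ≤ (j + m) !
m^j*m!≤[m+j]! m zero    = ≤-reflexive (*-identityˡ (m !))
m^j*m!≤[m+j]! m (suc j) = ≤-trans (≤-reflexive (*-assoc m (m ^ j) (m !)))
  (*-mono-≤ (m≤n+m m (suc j)) (m^j*m!≤[m+j]! m j))

-- Binomial coefficients are at most powers of two, by Pascal's rule multiplied through by the
-- factorials.
[i+j]!≤2^[i+j]*i!*j! : ∀ i j → (i + j) ! ≤ 2 ^ (i + j) * (i ! * j !)
[i+j]!≤2^[i+j]*i!*j! zero    j = ≤-trans (m≤n*m (j !) (2 ^ j) {{m^n≢0 2 j}})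
  (≤-reflexive (cong (2 ^ j *_) (sym (*-identityˡ (j !)))))
[i+j]!≤2^[i+j]*i!*j! (suc i) zero = ≤-trans (≤-reflexive (cong _! (+-identityʳ (suc i))))
  (≤-trans (m≤n*m (suc i !) (2 ^ (suc i + 0)) {{m^n≢0 2 (suc i + 0)}})
    (≤-reflexive (cong (2 ^ (suc i + 0) *_) (sym (*-identityʳ (suc i !))))))
[i+j]!≤2^[i+j]*i!*j! (suc i) (suc j) = begin
  (suc i + suc j) * (i + suc j) !
    ≡⟨ *-distribʳ-+ ((i + suc j) !) (suc i) (suc j) ⟩
  suc i * (i + suc j) ! + suc j * (i + suc j) !
    ≡⟨ cong (λ k → suc i * (i + suc j) ! + suc j * k !) (+-suc i j) ⟩
  suc i * (i + suc j) ! + suc j * (suc i + j) !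
    ≤⟨ +-mono-≤ (*-monoʳ-≤ (suc i) ([i+j]!≤2^[i+j]*i!*j! i (suc j)))
                (*-monoʳ-≤ (suc j) ([i+j]!≤2^[i+j]*i!*j! (suc i) j)) ⟩
  suc i * (2 ^ (i + suc j) * (i ! * suc j !)) + suc j * (2 ^ (suc i + j) * (suc i ! * j !))
    ≡⟨ cong (λ k → suc i * (2 ^ (i + suc j) * (i ! * suc j !)) + suc j * (2 ^ k * (suc i ! * j !)))
            (sym (+-suc i j)) ⟩
  suc i * (2 ^ (i + suc j) * (i ! * suc j !)) + suc j * (2 ^ (i + suc j) * (suc i ! * j !))
    ≡⟨ eq (suc i) (suc j) (2 ^ (i + suc j)) (i !) (j !) ⟩
  2 ^ (suc i + suc j) * (suc i ! * suc j !) ∎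
  where
  open ≤-Reasoning
  eq : ∀ a b p x y → a * (p * (x * (b * y))) + b * (p * (a * x * y)) ≡ 2 * p * (a * x * (b * y))
  eq = solve-∀

-- The term m^j / j! is at most the binomial coefficient (j + m)! / (j! m!).
m^j≤2^[m+j]*j! : ∀ m j → m ^ j ≤ 2 ^ (j + m) * j !
m^j≤2^[m+j]*j! m j = *-cancelʳ-≤ _ _ (m !) {{m !≢0}} (≤-trans (m^j*m!≤[m+j]! m j)
  (≤-trans ([i+j]!≤2^[i+j]*i!*j! j m) (≤-reflexive (sym (*-assoc (2 ^ (j + m)) (j !) (m !))))))

expTerm-fromℕ : ∀ m j → expTerm (fromℕ m) j ℚ.* fromℕ (j !) ≡ fromℕ (m ^ j)
expTerm-fromℕ m zero    = ℚₚ.*-identityˡ _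
expTerm-fromℕ m (suc j) = begin
  t ℚ.* (s ℚ.* r) ℚ.* fromℕ (suc j * j !)
    ≡⟨ cong (t ℚ.* (s ℚ.* r) ℚ.*_) (fromℕ-* (suc j) (j !)) ⟩
  t ℚ.* (s ℚ.* r) ℚ.* (fromℕ (suc j) ℚ.* fromℕ (j !))
    ≡⟨ solve 5 (λ t s r k f → t :* (s :* r) :* (k :* f) := s :* (t :* f) :* (r :* k)) refl
         t s r (fromℕ (suc j)) (fromℕ (j !)) ⟩
  s ℚ.* (t ℚ.* fromℕ (j !)) ℚ.* (r ℚ.* fromℕ (suc j))
    ≡⟨ cong₂ (λ x y → s ℚ.* x ℚ.* y) (expTerm-fromℕ m j) (recip-inverse (suc j)) ⟩
  s ℚ.* fromℕ (m ^ j) ℚ.* 1ℚ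
    ≡⟨ ℚₚ.*-identityʳ _ ⟩
  s ℚ.* fromℕ (m ^ j)
    ≡⟨ sym (fromℕ-* m (m ^ j)) ⟩
  fromℕ (m ^ suc j) ∎
  where
  open ≡-Reasoning
  open +-*-Solver
  s = fromℕ m
  t = expTerm s j
  r = recip (suc j)

expTerm≤2^ : ∀ m j → expTerm (fromℕ m) j ℚ.≤ fromℕ (2 ^ (j + m))
expTerm≤2^ m j = ℚₚ.*-cancelʳ-≤-pos (fromℕ (j !)) {{fromℕ-pos (j !) {{j !≢0}}}}
  (subst₂ ℚ._≤_ (sym (expTerm-fromℕ m j)) (fromℕ-* (2 ^ (j + m)) (j !))
    (fromℕ-mono-≤ {m ^ j} {2 ^ (j + m) * j !} (m^j≤2^[m+j]*j! m j)))

expPartial≤2^ : ∀ m j → expPartial (fromℕ m) j ℚ.≤ fromℕ (2 ^ (j + m))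
expPartial≤2^ m zero    = fromℕ-mono-≤ {0} {2 ^ m} z≤n
expPartial≤2^ m (suc j) = ℚₚ.≤-trans (ℚₚ.+-mono-≤ (expPartial≤2^ m j) (expTerm≤2^ m j))
  (ℚₚ.≤-reflexive (trans (sym (fromℕ-+ (2 ^ (j + m)) (2 ^ (j + m))))
    (cong fromℕ (cong (2 ^ (j + m) +_) (sym (+-identityʳ (2 ^ (j + m))))))))

-- From index 2m on the terms at least halve; the partial sum and twice the next term there are at
-- most 8^m and 2 · 8^m.
exp-fromℕ-bound : ∀ m k → expPartial (fromℕ m) k ℚ.≤ fromℕ (3 * 8 ^ m)
exp-fromℕ-bound m k = ℚₚ.≤-trans
  (expPartial-bound (fromℕ m) {{fromℕ-nonNeg m}} (2 * m)
    (subst (ℚ._≤ fromℕ (suc (2 * m))) (fromℕ-* 2 m)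
      (fromℕ-mono-≤ {2 * m} {suc (2 * m)} (n≤1+n (2 * m)))) k)
  (ℚₚ.≤-trans
    (ℚₚ.+-mono-≤ (expPartial≤2^ m (2 * m))
      (ℚₚ.*-monoˡ-≤-nonNeg (fromℕ 2) (expTerm≤2^ m (2 * m))))
    (ℚₚ.≤-reflexive (trans (cong (fromℕ p ℚ.+_) (sym (fromℕ-* 2 p)))
      (trans (sym (fromℕ-+ p (2 * p))) (cong (λ q → fromℕ (3 * q)) p≡8^m)))))
  where
  p = 2 ^ (2 * m + m)
  p≡8^m : p ≡ 8 ^ m
  p≡8^m = trans (cong (2 ^_) (+-comm (2 * m) m)) (sym (^-*-assoc 2 3 m))

-- Choice of the constants

private
  256·3^20≤4^20 : 2 ^ 8 * 3 ^ 20 ≤ 4 ^ 20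
  256·3^20≤4^20 = ≤ᵇ⇒≤ (2 ^ 8 * 3 ^ 20) (4 ^ 20) tt

-- 20 is the least exponent with (4/3)^20 ≥ 2^8.
2^8M·3^r≤4^r : ∀ M r → M * 20 ≤ r → 2 ^ (8 * M) * 3 ^ r ≤ 4 ^ r
2^8M·3^r≤4^r M r K≤r = begin
  2 ^ (8 * M) * 3 ^ r                       ≡⟨ cong (λ r → 2 ^ (8 * M) * 3 ^ r) r≡ ⟩
  2 ^ (8 * M) * 3 ^ (20 * M + k)            ≡⟨ cong (2 ^ (8 * M) *_) (^-distribˡ-+-* 3 (20 * M) k) ⟩
  2 ^ (8 * M) * (3 ^ (20 * M) * 3 ^ k)      ≡⟨ sym (*-assoc (2 ^ (8 * M)) (3 ^ (20 * M)) (3 ^ k)) ⟩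
  2 ^ (8 * M) * 3 ^ (20 * M) * 3 ^ k        ≡⟨ cong (_* 3 ^ k) power ⟩
  (2 ^ 8 * 3 ^ 20) ^ M * 3 ^ k              ≤⟨ *-mono-≤ (^-monoˡ-≤ M 256·3^20≤4^20) (^-monoˡ-≤ k (n≤1+n 3)) ⟩
  (4 ^ 20) ^ M * 4 ^ k                      ≡⟨ cong (_* 4 ^ k) (^-*-assoc 4 20 M) ⟩
  4 ^ (20 * M) * 4 ^ k                      ≡⟨ sym (^-distribˡ-+-* 4 (20 * M) k) ⟩
  4 ^ (20 * M + k)                          ≡⟨ cong (4 ^_) (sym r≡) ⟩
  4 ^ r                                     ∎
  where
  open ≤-Reasoning
  k = r ∸ M * 20
  r≡ : r ≡ 20 * M + k
  r≡ = trans (sym (m+[n∸m]≡n K≤r)) (cong (_+ k) (*-comm M 20))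
  power : 2 ^ (8 * M) * 3 ^ (20 * M) ≡ (2 ^ 8 * 3 ^ 20) ^ M
  power = trans (cong₂ _*_ (sym (^-*-assoc 2 8 M)) (sym (^-*-assoc 3 20 M)))
                (sym (^-distribˡ-* M (2 ^ 8) (3 ^ 20)))

few-survivors : ∀ L t N → 0 < L → 2 * (L * L) * t ≤ N →
  2 ^ t * wordSum (indicator ∘ confined L ℤ.0ℤ) N ≤ 2 * 2 ^ N
few-survivors L t N 0<L Qt≤N = *-cancelʳ-≤ _ _ (q ^ N) {{m^n≢0 q N}} (begin
  2 ^ t * S * q ^ N        ≡⟨ swap (2 ^ t) S (q ^ N) ⟩
  2 ^ t * q ^ N * S        ≤⟨ *-monoˡ-≤ S (halvings q t N (subst (λ Q → Q * t ≤ N) (sym 1+q≡Q) Qt≤N)) ⟩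
  suc q ^ N * S            ≤⟨ few-confined L q 1+q≡Q 0<L N ⟩
  2 * (2 * q) ^ N          ≡⟨ cong (2 *_) (^-distribˡ-* N 2 q) ⟩
  2 * (2 ^ N * q ^ N)      ≡⟨ sym (*-assoc 2 (2 ^ N) (q ^ N)) ⟩
  2 * 2 ^ N * q ^ N        ∎)
  where
  open ≤-Reasoning
  S = wordSum (indicator ∘ confined L ℤ.0ℤ) N
  q = 2 * (L * L) ∸ 1
  2≤Q : 2 ≤ 2 * (L * L)
  2≤Q = *-monoʳ-≤ 2 (*-mono-≤ 0<L 0<L)
  1+q≡Q : suc q ≡ 2 * (L * L)
  1+q≡Q = m+[n∸m]≡n (≤-trans (n≤1+n 1) 2≤Q)
  instance
    q≢0 : NonZero q
    q≢0 = >-nonZero (∸-monoˡ-≤ 1 2≤Q)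
  swap : ∀ a s b → a * s * b ≡ a * b * s
  swap = solve-∀

-- For L = 120 n M the confinement estimate decays like 2^(−N / 2L²), and
-- threshold n · M³ = 2L² · 8M.
threshold : ℕ → ℕ
threshold n = 16 * ((20 * 6 * n) * (20 * 6 * n))

module _ (n : ℕ) .{{_ : NonZero n}} where

  private
    totalCount-pos : ∀ N → 0 < totalCount n N
    totalCount-pos N = *-mono-≤ n·2^N>0 n·2^N>0
      where
      n·2^N>0 : 0 < n * 2 ^ N
      n·2^N>0 = *-mono-≤ (>-nonZero⁻¹ n) (m^n>0 2 N)

  goodCount-decay : ∀ M N → 0 < M → threshold n * (M * M * M) ≤ N →
    2 ^ (8 * M) * goodCount n N ≤ 3 * totalCount n N
  goodCount-decay M N 0<M large = goodCount-bound n {c = 2 ^ (8 * M)} {K = M * 20} (2^8M·3^r≤4^r M) N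
    (few-survivors (M * 20 * 6 * n) (8 * M) N
      (*-mono-≤ (*-mono-≤ (*-mono-≤ 0<M (s≤s (z≤n {19}))) (s≤s (z≤n {5}))) (>-nonZero⁻¹ n))
      (≤-trans (≤-reflexive exponent) large))
    where
    rearrange : ∀ M e → 2 * ((M * e) * (M * e)) * (8 * M) ≡ 16 * (e * e) * (M * M * M)
    rearrange = solve-∀
    exponent : 2 * ((M * 20 * 6 * n) * (M * 20 * 6 * n)) * (8 * M) ≡ threshold n * (M * M * M)
    exponent = trans
      (cong (λ L → 2 * (L * L) * (8 * M)) (trans (cong (_* n) (*-assoc M 20 6)) (*-assoc M (20 * 6) n)))
      (rearrange M (20 * 6 * n))

  -- Why the decay is tuned to 2^8 = 8 · 32 per unit of `M`: the 8 pays for the bound 3 · 8^M on the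
  -- exponential, and one 32 absorbs the constant 9.
  goodCount-below : ∀ M N → 0 < M → threshold n * (M * M * M) ≤ N →
    3 * 8 ^ M * goodCount n N < totalCount n N
  goodCount-below M N 0<M large = *-cancelˡ-< (32 ^ M) _ _ (begin-strict
    32 ^ M * (3 * 8 ^ M * g)       ≡⟨ swap (32 ^ M) (8 ^ M) g ⟩
    3 * (8 ^ M * 32 ^ M * g)       ≡⟨ cong (λ p → 3 * (p * g)) (trans (sym (^-distribˡ-* M 8 32)) (^-*-assoc 2 8 M)) ⟩
    3 * (2 ^ (8 * M) * g)          ≤⟨ *-monoʳ-≤ 3 (goodCount-decay M N 0<M large) ⟩
    3 * (3 * t)                    ≡⟨ sym (*-assoc 3 3 t) ⟩
    9 * t                          <⟨ *-monoˡ-< t {{>-nonZero (totalCount-pos N)}} (≤ᵇ⇒≤ 10 32 tt) ⟩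
    32 * t                         ≤⟨ *-monoˡ-≤ t (^-monoʳ-≤ 32 0<M) ⟩
    32 ^ M * t                     ∎)
    where
    open ≤-Reasoning
    g = goodCount n N
    t = totalCount n N
    swap : ∀ a b g → a * (3 * b * g) ≡ 3 * (b * a * g)
    swap = solve-∀

  -- The success probability is at most 1 - 1/n, and (1 - 1/n)(1 + 1/n) < 1; for small `N` the
  -- factor 1 + 1/n bounds the exponential.
  [1+n]·goodCount<n·totalCount : ∀ N → suc n * goodCount n N < n * totalCount n N
  [1+n]·goodCount<n·totalCount N = begin-strict
    g + n * g                  <⟨ +-monoˡ-< (n * g) g<t ⟩
    t + n * g                  ≡⟨ trans (+-comm t (n * g)) (cong (n * g +_) (total n (2 ^ N))) ⟩
    n * g + n * (n * b)        ≡⟨ sym (*-distribˡ-+ n g (n * b)) ⟩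
    n * (g + n * b)            ≤⟨ *-monoʳ-≤ n (goodCount-gap n N) ⟩
    n * t                      ∎
    where
    open ≤-Reasoning
    g = goodCount n N
    t = totalCount n N
    b = 2 ^ N * 2 ^ N
    total : ∀ n p → (n * p) * (n * p) ≡ n * (n * (p * p))
    total = solve-∀
    g<t : g < t
    g<t = ≤-trans (≤-trans (≤-reflexive (+-comm 1 g))
      (+-monoʳ-≤ g (*-mono-≤ (>-nonZero⁻¹ n) (*-mono-≤ (m^n>0 2 N) (m^n>0 2 N))))) (goodCount-gap n N)

-- Scale and rate of decay

private
  m<8*m : ∀ m .{{_ : NonZero m}} → m < 8 * m
  m<8*m m = subst (m <_) (*-comm m 8) (m<m*n m 8 (s≤s (s≤s z≤n)))

-- Induction on `N` replaces a cube root: `M` is kept until `N` reaches 8 T M^3 = T (2M)^3, and is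
-- then doubled.
dyadic-scale : ∀ T → 0 < T → ∀ N → T ≤ N →
  ∃ λ M → 0 < M × T * (M * M * M) ≤ N × N < 8 * T * (M * M * M)
dyadic-scale T 0<T zero    T≤0 = contradiction (≤-trans 0<T T≤0) (λ ())
dyadic-scale T 0<T (suc N) T≤1+N with T ≤? N
... | no T≰N = 1 , s≤s z≤n , ≤-trans (≤-reflexive (*-identityʳ T)) T≤1+N , (begin-strict
    suc N            ≤⟨ ≰⇒> T≰N ⟩
    T                <⟨ m<8*m T {{>-nonZero 0<T}} ⟩
    8 * T            ≡⟨ sym (*-identityʳ (8 * T)) ⟩
    8 * T * 1        ∎)
  where open ≤-Reasoning
... | yes T≤N with dyadic-scale T 0<T N T≤N
...   | M , 0<M , lower , upper with m≤n⇒m<n∨m≡n upper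
...     | inj₁ 1+N< = M , 0<M , ≤-trans lower (n≤1+n N) , 1+N<
...     | inj₂ 1+N≡ = 2 * M , *-mono-≤ (s≤s (z≤n {1})) 0<M ,
            ≤-reflexive (trans (double T M) (sym 1+N≡)) , (begin-strict
    suc N                                    ≡⟨ 1+N≡ ⟩
    8 * T * (M * M * M)                      <⟨ m<8*m (8 * T * (M * M * M)) {{nz}} ⟩
    8 * (8 * T * (M * M * M))                ≡⟨ double′ T M ⟩
    8 * T * (2 * M * (2 * M) * (2 * M))      ∎)
  where
  open ≤-Reasoning
  nz : NonZero (8 * T * (M * M * M))
  nz = subst NonZero 1+N≡ _
  double : ∀ T M → T * (2 * M * (2 * M) * (2 * M)) ≡ 8 * T * (M * M * M)
  double = solve-∀
  double′ : ∀ T M → 8 * (8 * T * (M * M * M)) ≡ 8 * T * (2 * M * (2 * M) * (2 * M))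
  double′ = solve-∀

private
  *-≤1 : ∀ a b .{{_ : ℚ.NonNegative a}} → a ℚ.≤ 1ℚ → b ℚ.≤ 1ℚ → a ℚ.* b ℚ.≤ 1ℚ
  *-≤1 a b a≤1 b≤1 = ℚₚ.≤-trans
    (subst (a ℚ.* b ℚ.≤_) (ℚₚ.*-identityʳ a) (ℚₚ.*-monoˡ-≤-nonNeg a b≤1)) a≤1

  -- One `τ` is kept to be set against `ν`, the other two are bounded by 1.
  cube-* : ∀ x τ ν .{{_ : ℚ.NonNegative x}} .{{_ : ℚ.NonNegative τ}} .{{_ : ℚ.NonNegative ν}} →
    τ ℚ.≤ 1ℚ →
    (x ℚ.* τ) ℚ.* (x ℚ.* τ) ℚ.* (x ℚ.* τ) ℚ.* ν ℚ.≤ x ℚ.* x ℚ.* x ℚ.* (τ ℚ.* ν)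
  cube-* x τ ν τ≤1 = subst₂ ℚ._≤_
    (solve 3 (λ x t v → x :* x :* x :* (t :* v) :* (t :* t) := (x :* t) :* (x :* t) :* (x :* t) :* v) refl x τ ν)
    (ℚₚ.*-identityʳ y)
    (ℚₚ.*-monoˡ-≤-nonNeg y {{y≥0}} (*-≤1 τ τ τ≤1 τ≤1))
    where
    open +-*-Solver
    y = x ℚ.* x ℚ.* x ℚ.* (τ ℚ.* ν)
    y≥0 : ℚ.NonNegative y
    y≥0 = ℚₚ.nonNeg*nonNeg⇒nonNeg (x ℚ.* x ℚ.* x)
      {{ℚₚ.nonNeg*nonNeg⇒nonNeg (x ℚ.* x) {{ℚₚ.nonNeg*nonNeg⇒nonNeg x x}} x}}
      (τ ℚ.* ν) {{ℚₚ.nonNeg*nonNeg⇒nonNeg τ ν}}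

module _ (n : ℕ) .{{_ : NonZero n}} (T : ℕ) .{{_ : NonZero T}} where

  private
    instance
      8T≢0 : NonZero (8 * T)
      8T≢0 = m*n≢0 8 T

  -- 1/(2n) makes the bound 1 + 2s on e^s equal to 1 + 1/n. In `rate`, it adapts the decay to small
  -- `N`, while 1/(8T) matches the upper end 8 T M^3 of the dyadic range.
  shortExponent rate : ℚ
  shortExponent = ½ ℚ.* recip n
  rate          = shortExponent ℚ.* recip (8 * T)

  private
    x τ : ℚ
    x = shortExponent
    τ = recip (8 * T)

    instance
      x>0 : ℚ.Positive x
      x>0 = ℚₚ.pos*pos⇒pos ½ (recip n) {{recip-pos n}}
      x≥0 : ℚ.NonNegative x
      x≥0 = ℚₚ.pos⇒nonNeg x
      τ>0 : ℚ.Positive τ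
      τ>0 = recip-pos (8 * T)
      τ≥0 : ℚ.NonNegative τ
      τ≥0 = ℚₚ.pos⇒nonNeg τ

    x≤1 : x ℚ.≤ 1ℚ
    x≤1 = *-≤1 ½ (recip n) (ℚₚ.≤ᵇ⇒≤ {½} {1ℚ} tt) (recip≤1 n)

    x²>0 : ℚ.Positive (x ℚ.* x)
    x²>0 = ℚₚ.pos*pos⇒pos x x

    x³>0 : ℚ.Positive (x ℚ.* x ℚ.* x)
    x³>0 = ℚₚ.pos*pos⇒pos (x ℚ.* x) {{x²>0}} x

    x³≤1 : x ℚ.* x ℚ.* x ℚ.≤ 1ℚ
    x³≤1 = *-≤1 (x ℚ.* x) x {{ℚₚ.nonNeg*nonNeg⇒nonNeg x x}} (*-≤1 x x x≤1 x≤1) x≤1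

    rate-cube≤ : ∀ N → rate ℚ.* rate ℚ.* rate ℚ.* fromℕ N ℚ.≤ x ℚ.* x ℚ.* x ℚ.* (τ ℚ.* fromℕ N)
    rate-cube≤ N = cube-* x τ (fromℕ N) {{x≥0}} {{τ≥0}} {{fromℕ-nonNeg N}} (recip≤1 (8 * T))

  rate-positive : 0ℚ ℚ.< rate
  rate-positive = ℚₚ.positive⁻¹ rate {{ℚₚ.pos*pos⇒pos x τ}}

  short-rate : ∀ N → N < 8 * T →
    rate ℚ.* rate ℚ.* rate ℚ.* fromℕ N ℚ.< x ℚ.* x ℚ.* x
  short-rate N N<8T = ℚₚ.≤-<-trans (rate-cube≤ N)
    (subst (x ℚ.* x ℚ.* x ℚ.* (τ ℚ.* fromℕ N) ℚ.<_)
      (trans (cong (x ℚ.* x ℚ.* x ℚ.*_) (recip-inverse (8 * T))) (ℚₚ.*-identityʳ (x ℚ.* x ℚ.* x)))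
      (ℚₚ.*-monoʳ-<-pos (x ℚ.* x ℚ.* x) {{x³>0}}
        (ℚₚ.*-monoʳ-<-pos τ (fromℕ-mono-< {N} {8 * T} N<8T))))

  long-rate : ∀ M N → N < 8 * T * (M * M * M) →
    rate ℚ.* rate ℚ.* rate ℚ.* fromℕ N ℚ.< fromℕ M ℚ.* fromℕ M ℚ.* fromℕ M
  long-rate M N N< = ℚₚ.≤-<-trans
    (ℚₚ.≤-trans (rate-cube≤ N) (subst (x ℚ.* x ℚ.* x ℚ.* y ℚ.≤_) (ℚₚ.*-identityˡ y)
      (ℚₚ.*-monoʳ-≤-nonNeg y {{ℚₚ.nonNeg*nonNeg⇒nonNeg τ (fromℕ N) {{fromℕ-nonNeg N}}}} x³≤1)))
    (subst (y ℚ.<_) cube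
      (ℚₚ.*-monoʳ-<-pos τ (fromℕ-mono-< {N} {8 * T * (M * M * M)} N<)))
    where
    y = τ ℚ.* fromℕ N
    cube : τ ℚ.* fromℕ (8 * T * (M * M * M)) ≡ fromℕ M ℚ.* fromℕ M ℚ.* fromℕ M
    cube = begin
      τ ℚ.* fromℕ (8 * T * (M * M * M))
        ≡⟨ cong (τ ℚ.*_) (fromℕ-* (8 * T) (M * M * M)) ⟩
      τ ℚ.* (fromℕ (8 * T) ℚ.* fromℕ (M * M * M))
        ≡⟨ sym (ℚₚ.*-assoc τ (fromℕ (8 * T)) (fromℕ (M * M * M))) ⟩
      τ ℚ.* fromℕ (8 * T) ℚ.* fromℕ (M * M * M)
        ≡⟨ cong (ℚ._* fromℕ (M * M * M)) (recip-inverse (8 * T)) ⟩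
      1ℚ ℚ.* fromℕ (M * M * M)
        ≡⟨ ℚₚ.*-identityˡ (fromℕ (M * M * M)) ⟩
      fromℕ (M * M * M)
        ≡⟨ fromℕ-* (M * M) M ⟩
      fromℕ (M * M) ℚ.* fromℕ M
        ≡⟨ cong (ℚ._* fromℕ M) (fromℕ-* M M) ⟩
      fromℕ M ℚ.* fromℕ M ℚ.* fromℕ M ∎
      where open ≡-Reasoning

  -- Tokens starting together already account for a fraction 1/n of the outcomes.
  short-probability : ∀ N → ProbBelowExpNeg shortExponent (goodCount n N) (totalCount n N)
  short-probability N = 1ℚ ℚ.+ r , exp-bound , ℚₚ.*-cancelˡ-<-nonNeg (fromℕ n) {{fromℕ-nonNeg n}}
    (subst₂ ℚ._<_ scaled (fromℕ-* n t)
      (fromℕ-mono-< {suc n * g} {n * t} ([1+n]·goodCount<n·totalCount n N)))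
    where
    r = recip n
    g = goodCount n N
    t = totalCount n N
    2x≤2 : fromℕ 2 ℚ.* x ℚ.≤ fromℕ 2
    2x≤2 = subst (fromℕ 2 ℚ.* x ℚ.≤_) (ℚₚ.*-identityʳ (fromℕ 2)) (ℚₚ.*-monoˡ-≤-nonNeg (fromℕ 2) x≤1)
    first-term : expTerm x 1 ≡ x
    first-term = trans (ℚₚ.*-identityˡ (x ℚ.* 1ℚ)) (ℚₚ.*-identityʳ x)
    2x≡r : fromℕ 2 ℚ.* x ≡ r
    2x≡r = trans (sym (ℚₚ.*-assoc (fromℕ 2) ½ r)) (ℚₚ.*-identityˡ r)
    exp-bound : ∀ k → expPartial x k ℚ.≤ 1ℚ ℚ.+ r
    exp-bound k = subst (expPartial x k ℚ.≤_)
      (cong₂ ℚ._+_ (ℚₚ.+-identityˡ 1ℚ) (trans (cong (fromℕ 2 ℚ.*_) first-term) 2x≡r))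
      (expPartial-bound x 1 2x≤2 k)
    scaled : fromℕ (suc n * g) ≡ fromℕ n ℚ.* ((1ℚ ℚ.+ r) ℚ.* fromℕ g)
    scaled = begin
      fromℕ (suc n * g)                                ≡⟨ fromℕ-* (suc n) g ⟩
      fromℕ (1 + n) ℚ.* fromℕ g                        ≡⟨ cong (ℚ._* fromℕ g) (fromℕ-+ 1 n) ⟩
      (1ℚ ℚ.+ fromℕ n) ℚ.* fromℕ g                     ≡⟨ cong (λ e → (e ℚ.+ fromℕ n) ℚ.* fromℕ g) (sym (recip-inverse n)) ⟩
      (r ℚ.* fromℕ n ℚ.+ fromℕ n) ℚ.* fromℕ g          ≡⟨ rearrange r (fromℕ n) (fromℕ g) ⟩
      fromℕ n ℚ.* ((1ℚ ℚ.+ r) ℚ.* fromℕ g)             ∎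
      where
      open ≡-Reasoning
      open +-*-Solver
      rearrange : ∀ r m c → (r ℚ.* m ℚ.+ m) ℚ.* c ≡ m ℚ.* ((1ℚ ℚ.+ r) ℚ.* c)
      rearrange = solve 3 (λ r m c → (r :* m :+ m) :* c := m :* ((con 1ℚ :+ r) :* c)) refl

  -- The rational `s` lies above c N^(1/3) for c = `rate`, so a probability below e^(-s) is below
  -- e^(-c N^(1/3)) and no cube root is taken.
  Decays : ℕ → ℚ → Set
  Decays N s = (0ℚ ℚ.≤ s) × ((rate ℚ.* rate ℚ.* rate ℚ.* fromℕ N ℚ.< s ℚ.* s ℚ.* s) ×
    ProbBelowExpNeg s (goodCount n N) (totalCount n N))

  decay : (∀ M N → 0 < M → T * (M * M * M) ≤ N →
      ProbBelowExpNeg (fromℕ M) (goodCount n N) (totalCount n N)) →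
    ∀ N → Σ ℚ (Decays N)
  decay long-probability N = by-size (T ≤? N)
    where
    long : (∃ λ M → 0 < M × T * (M * M * M) ≤ N × N < 8 * T * (M * M * M)) → Σ ℚ (Decays N)
    long (M , 0<M , lower , upper) = fromℕ M ,
      ℚₚ.nonNegative⁻¹ (fromℕ M) {{fromℕ-nonNeg M}} , long-rate M N upper , long-probability M N 0<M lower
    by-size : Dec (T ≤ N) → Σ ℚ (Decays N)
    by-size (no T≰N)  = x , ℚₚ.nonNegative⁻¹ x ,
      short-rate N (≤-trans (≰⇒> T≰N) (m≤n*m T 8)) , short-probability N
    by-size (yes T≤N) = long (dyadic-scale T (>-nonZero⁻¹ T) N T≤N)

module _ (n : ℕ) .{{_ : NonZero n}} where

  long-probability : ∀ M N → 0 < M → threshold n * (M * M * M) ≤ N →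
    ProbBelowExpNeg (fromℕ M) (goodCount n N) (totalCount n N)
  long-probability M N 0<M large = fromℕ (3 * 8 ^ M) , exp-fromℕ-bound M ,
    subst (ℚ._< fromℕ (totalCount n N)) (fromℕ-* (3 * 8 ^ M) (goodCount n N))
      (fromℕ-mono-< {3 * 8 ^ M * goodCount n N} {totalCount n N} (goodCount-below n M N 0<M large))

  threshold-nonZero : NonZero (threshold n)
  threshold-nonZero = >-nonZero (*-mono-≤ (s≤s (z≤n {15})) (*-mono-≤ 120n>0 120n>0))
    where
    120n>0 : 0 < 20 * 6 * n
    120n>0 = *-mono-≤ (s≤s (z≤n {119})) (>-nonZero⁻¹ n)

open import Data.Integer using (+_)

theorem3p4 : (n : ℕ) → .{{_ : NonZero n}} → 3 ≤ n →
    Σ ℚ (λ c → (ℚ.0ℚ ℚ.< c) ×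
    ((N : ℕ) → 1 ≤ N →
    Σ ℚ (λ s → (ℚ.0ℚ ℚ.≤ s) ×
    ((c ℚ.* c ℚ.* c ℚ.* (+ N ℚ./ 1) ℚ.< s ℚ.* s ℚ.* s) ×
    ProbBelowExpNeg s (goodCount n N) (totalCount n N)))))
theorem3p4 n _ = rate n T₀ , rate-positive n T₀ , λ N _ → decay n T₀ (long-probability n) N
  where
  T₀ = threshold n
  instance
    T₀≢0 : NonZero T₀
    T₀≢0 = threshold-nonZero n
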